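{- There is a monadic second-order ($\mathsf{MSO}$) transduction $\tau$ from structures over the vocabulary $\{\mathsf{SET}\}$ to structures over the vocabulary $\{\mathsf{desc}\}$ such that, for every laminar set system $(U,\mathcal F)$, modelled as a $\{\mathsf{SET}\}$-structure $\mathbb F$, the set $\tau(\mathbb F)$ is non-empty and every structure in $\tau(\mathbb F)$ is isomorphic, as a $\{\mathsf{desc}\}$-structure, to the laminar tree of $(U,\mathcal F)$.
   Context: All structures are finite. An extended relational vocabulary is a set of symbols, each with an arity, where each symbol is either a relation name (interpreted by a relation on elements) or a set predicate name (interpreted by a relation on subsets of the universe). $\mathsf{MSO}$ is monadic second-order logic (quantification over elements and over sets of elements, no counting predicates); set predicates may be applied to set variables. Set systems. A set system $(U,\mathcal F)$ is a finite non-empty set $U$ with a family $\mathcal F$ of non-empty subsets of $U$. It is modelled by the $\{\mathsf{SET}\}$-structure with universe $U$, where $\mathsf{SET}$ is a unary set predicate and $\mathsf{SET}(X)$ holds iff $X\in\mathcal F$. It is laminar if $U\in\mathcal F$, $\{u\}\in\mathcal F$ for all $u\in U$, and for all $F_1,F_2\in\mathcal F$ the set $F_1\cap F_2$ is one of $\emptyset,F_1,F_2$. The laminar tree of a laminar set system $(U,\mathcal F)$ is the rooted tree whose nodes correspond bijectively to the sets in $\mathcal F$, where the node of $F$ is a descendant of the node of $F'$ iff $F\subseteq F'$; so $U$ is the root and the singletons are the leaves. A rooted tree $T$ is modelled by the $\{\mathsf{desc}\}$-structure with universe $V(T)$, where $\mathsf{desc}(x,y)$ holds iff $x$ is a (not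 necessarily proper) descendant of $y$. Transductions. A transduction from vocabulary $\Sigma$ to $\Gamma$ is a set $\tau$ of pairs ($\Sigma$-structure, $\Gamma$-structure); $\tau(\mathbb A)=\{\mathbb B:(\mathbb A,\mathbb B)\in\tau\}$. An $\mathsf{MSO}$-transduction is a composition of finitely many atomic transductions of the kinds: (Colouring) for some $k$, add $k$ new unary relations, every possible interpretation giving an output; (Copying) for some $k$, add $k$ disjoint copies of the universe, keep the old relations and predicates on the original elements, and add binary relations $\mathsf{copy}_i(x,y)$, $0\le i\le k$, saying that $x$ is the $i$-th copy of the original element $y$ (with $\mathsf{copy}_0(x,y)$ meaning $x=y$ is original); (Filtering) for an $\mathsf{MSO}$-sentence $\chi$, output the input unchanged if it satisfies $\chi$ and output nothing otherwise; (Interpretation) given $\mathsf{MSO}$-formulas $\phi(x)$ and $\psi_Q$ for $Q\in\Gamma$ (with as many free variables as the arity of $Q$, set variables if $Q$ is a set predicate), output the $\Gamma$-structure whose universe is the set of elements satisfying $\phi$ and in which each $Q\in\Gamma$ is interpreted as the set of tuples (over the new universe) satisfying $\psi_Q$. -}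

module Defs where

open import Data.Bool.Base using (Bool; true; false; T; _∧_)
open import Data.Bool.Properties using (T?; T-irrelevant)
open import Data.Empty using (⊥; ⊥-elim)
open import Data.Fin.Base using (Fin; zero; suc; combine; remainder)
open import Data.Fin.Properties using (_≟_; any?; all?)
open import Data.Fin.Subset as Subset
  using (Subset; inside; outside; _∈_; _⊆_; _⊂_; _∩_; ⁅_⁆; Nonempty)
open import Data.Fin.Subset.Induction using (⊂-wellFounded; ⊃-wellFounded)
open import Data.Fin.Subset.Properties
  using (_∈?_; _⊆?_; _⊂?_; anySubset?; ⊆-antisym; ⊆-refl; ⊆-trans;
         ⊆⊤; ∉⊥; p∩q⊆p; p∩q⊆q; x∈p∩q⁺)
open import Data.List.Base as List using (List; []; _∷_; length; allFin; filter)
open import Data.List.Membership.Propositional using () renaming (_∈_ to _∈ₗ_)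
open import Data.List.Membership.Propositional.Properties
  using (∈-map⁺; ∈-map⁻; ∈-++⁺ˡ; ∈-++⁺ʳ; ∈-filter⁺; ∈-filter⁻; ∈-lookup)
import Data.List.Relation.Unary.All as ListAll
import Data.List.Relation.Unary.Any as ListAny
open import Data.List.Relation.Unary.Any.Properties using (lookup-index)
open import Data.List.Relation.Unary.AllPairs using ([]; _∷_)
open import Data.List.Relation.Unary.Unique.Propositional using (Unique)
import Data.List.Relation.Unary.Unique.Propositional.Properties as Unique
open import Data.Maybe.Base using (Maybe; just; nothing)
open import Data.Maybe.Properties using (just-injective)
open import Data.Nat.Base using (ℕ; suc; _*_; NonZero)
open import Data.Product.Base using (∃; _×_; _,_; proj₁; proj₂; -,_)
open import Data.Sum.Base using (_⊎_; inj₁; inj₂; [_,_]′)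
open import Data.Vec.Base as Vec using (Vec; []; _∷_; lookup; tabulate)
import Data.Vec.Properties as Vecₚ
import Data.Vec.Relation.Unary.All as VecAll
open import Function.Base using (_∘_; case_of_)
open import Function.Bundles using (_⇔_; mk⇔; _⤖_; mk⤖; module Bijection)
open import Function.Consequences.Propositional
  using (strictlySurjective⇒surjective)
open import Induction.WellFounded using (Acc; acc)
open import Level using (0ℓ)
open import Relation.Binary.Construct.Closure.ReflexiveTransitive
  using (Star; ε; _◅_)
open import Relation.Binary.Construct.Closure.Transitive
  using (TransClosure; _∷_) renaming ([_] to [_]⁺)
open import Relation.Binary.Core using (REL)
open import Relation.Binary.Definitions using (Decidable)
open import Relation.Binary.PropositionalEquality
  using (_≡_; refl; sym; trans; cong; subst)
open import Relation.Nullary.Decidable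
  using (Dec; yes; no; does; ¬?; _×-dec_; _⊎-dec_; _→-dec_; map′;
         decidable-stable)
open import Relation.Nullary.Negation using (¬_; contradiction)

record Vocabulary : Set₁ where
  field
    RelName   : Set
    relArity  : RelName → ℕ
    PredName  : Set
    predArity : PredName → ℕ

open Vocabulary public

private
  variable
    Σ Γ : Vocabulary
    e m n s : ℕ

-- Universes are the sets Fin n, and relations are Bool-valued, so that
-- every formula has a truth value although the metatheory is constructive.
record Structure (Σ : Vocabulary) : Set where
  field
    size : ℕ
    rel  : (R : RelName Σ) → Vec (Fin size) (relArity Σ R) → Bool
    pred : (P : PredName Σ) → Vec (Subset size) (predArity Σ P) → Bool

open Structure public

image : (Fin m → Fin n) → Subset m → Subset n
image f X = tabulate λ y → does (any? λ x → (x ∈? X) ×-dec (f x ≟ y))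

preimage : (Fin m → Fin n) → Subset n → Subset m
preimage f Y = tabulate λ x → lookup Y (f x)

infix 4 _≅_

record _≅_ (𝔸 𝔹 : Structure Σ) : Set where
  field
    bijection : Fin (size 𝔸) ⤖ Fin (size 𝔹)

  open Bijection bijection public using (to)

  field
    rel-preserved  : ∀ R xs → rel 𝔸 R xs ≡ rel 𝔹 R (Vec.map to xs)
    pred-preserved : ∀ P Xs → pred 𝔸 P Xs ≡ pred 𝔹 P (Vec.map (image to) Xs)

infix  7 _≐_ _∈̇_
infix  6 ¬̇_
infixr 5 _∧̇_
infixr 4 _∨̇_
infixr 3 _⇒̇_

-- Formulas with e free element variables and s free set variables
-- (de Bruijn indices, separately for the two sorts).
data Formula (Σ : Vocabulary) (e s : ℕ) : Set where
  _≐_          : (x y : Fin e) → Formula Σ e s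
  _∈̇_          : (x : Fin e) (X : Fin s) → Formula Σ e s
  relation     : (R : RelName Σ) → Vec (Fin e) (relArity Σ R) → Formula Σ e s
  predicate    : (P : PredName Σ) → Vec (Fin s) (predArity Σ P) → Formula Σ e s
  ⊥̇            : Formula Σ e s
  ¬̇_           : Formula Σ e s → Formula Σ e s
  _∧̇_ _∨̇_ _⇒̇_  : (φ ψ : Formula Σ e s) → Formula Σ e s
  ∃ᵉ ∀ᵉ        : Formula Σ (suc e) s → Formula Σ e s
  ∃ˢ ∀ˢ        : Formula Σ e (suc s) → Formula Σ e s

Sentence : Vocabulary → Set
Sentence Σ = Formula Σ 0 0

infix 2 _[_,_]⊨_ _[_,_]⊨?_

_[_,_]⊨_ : (𝔸 : Structure Σ) → Vec (Fin (size 𝔸)) e → Vec (Subset (size 𝔸)) s →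
           Formula Σ e s → Set
𝔸 [ ρ , σ ]⊨ x ≐ y          = lookup ρ x ≡ lookup ρ y
𝔸 [ ρ , σ ]⊨ x ∈̇ X          = lookup ρ x ∈ lookup σ X
𝔸 [ ρ , σ ]⊨ relation R xs  = T (rel 𝔸 R (Vec.map (lookup ρ) xs))
𝔸 [ ρ , σ ]⊨ predicate P Xs = T (pred 𝔸 P (Vec.map (lookup σ) Xs))
𝔸 [ ρ , σ ]⊨ ⊥̇              = ⊥
𝔸 [ ρ , σ ]⊨ ¬̇ φ            = ¬ (𝔸 [ ρ , σ ]⊨ φ)
𝔸 [ ρ , σ ]⊨ φ ∧̇ ψ          = (𝔸 [ ρ , σ ]⊨ φ) × (𝔸 [ ρ , σ ]⊨ ψ)
𝔸 [ ρ , σ ]⊨ φ ∨̇ ψ          = (𝔸 [ ρ , σ ]⊨ φ) ⊎ (𝔸 [ ρ , σ ]⊨ ψ)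
𝔸 [ ρ , σ ]⊨ φ ⇒̇ ψ          = (𝔸 [ ρ , σ ]⊨ φ) → (𝔸 [ ρ , σ ]⊨ ψ)
𝔸 [ ρ , σ ]⊨ ∃ᵉ φ           = ∃ λ x → 𝔸 [ x ∷ ρ , σ ]⊨ φ
𝔸 [ ρ , σ ]⊨ ∀ᵉ φ           = ∀ x → 𝔸 [ x ∷ ρ , σ ]⊨ φ
𝔸 [ ρ , σ ]⊨ ∃ˢ φ           = ∃ λ X → 𝔸 [ ρ , X ∷ σ ]⊨ φ
𝔸 [ ρ , σ ]⊨ ∀ˢ φ           = ∀ X → 𝔸 [ ρ , X ∷ σ ]⊨ φ

allSubset? : {P : Subset n → Set} → (∀ X → Dec (P X)) → Dec (∀ X → P X)
allSubset? P? = map′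
  (λ ¬∃¬ X → decidable-stable (P? X) (λ ¬p → ¬∃¬ (X , ¬p)))
  (λ all (X , ¬p) → ¬p (all X))
  (¬? (anySubset? (¬? ∘ P?)))

_[_,_]⊨?_ : (𝔸 : Structure Σ) (ρ : Vec (Fin (size 𝔸)) e) (σ : Vec (Subset (size 𝔸)) s)
            (φ : Formula Σ e s) → Dec (𝔸 [ ρ , σ ]⊨ φ)
𝔸 [ ρ , σ ]⊨? x ≐ y          = lookup ρ x ≟ lookup ρ y
𝔸 [ ρ , σ ]⊨? x ∈̇ X          = lookup ρ x ∈? lookup σ X
𝔸 [ ρ , σ ]⊨? relation R xs  = T? _
𝔸 [ ρ , σ ]⊨? predicate P Xs = T? _
𝔸 [ ρ , σ ]⊨? ⊥̇              = no λ ()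
𝔸 [ ρ , σ ]⊨? ¬̇ φ            = ¬? (𝔸 [ ρ , σ ]⊨? φ)
𝔸 [ ρ , σ ]⊨? φ ∧̇ ψ          = (𝔸 [ ρ , σ ]⊨? φ) ×-dec (𝔸 [ ρ , σ ]⊨? ψ)
𝔸 [ ρ , σ ]⊨? φ ∨̇ ψ          = (𝔸 [ ρ , σ ]⊨? φ) ⊎-dec (𝔸 [ ρ , σ ]⊨? ψ)
𝔸 [ ρ , σ ]⊨? φ ⇒̇ ψ          = (𝔸 [ ρ , σ ]⊨? φ) →-dec (𝔸 [ ρ , σ ]⊨? ψ)
𝔸 [ ρ , σ ]⊨? ∃ᵉ φ           = any? λ x → 𝔸 [ x ∷ ρ , σ ]⊨? φ
𝔸 [ ρ , σ ]⊨? ∀ᵉ φ           = all? λ x → 𝔸 [ x ∷ ρ , σ ]⊨? φ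
𝔸 [ ρ , σ ]⊨? ∃ˢ φ           = anySubset? λ X → 𝔸 [ ρ , X ∷ σ ]⊨? φ
𝔸 [ ρ , σ ]⊨? ∀ˢ φ           = allSubset? λ X → 𝔸 [ ρ , X ∷ σ ]⊨? φ

colouredVocabulary : Vocabulary → ℕ → Vocabulary
colouredVocabulary Σ k = record
  { RelName   = RelName Σ ⊎ Fin k
  ; relArity  = [ relArity Σ , (λ _ → 1) ]′
  ; PredName  = PredName Σ
  ; predArity = predArity Σ
  }

colour : ∀ {Σ k} (𝔸 : Structure Σ) → (Fin k → Subset (size 𝔸)) →
         Structure (colouredVocabulary Σ k)
colour {Σ} {k} 𝔸 c = record
  { size = size 𝔸
  ; rel  = colouredRel
  ; pred = pred 𝔸
  }
  where
  colouredRel : ∀ R → Vec (Fin (size 𝔸)) (relArity (colouredVocabulary Σ k) R) → Bool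
  colouredRel (inj₁ R) xs       = rel 𝔸 R xs
  colouredRel (inj₂ i) (x ∷ []) = lookup (c i) x

copiedVocabulary : Vocabulary → ℕ → Vocabulary
copiedVocabulary Σ k = record
  { RelName   = RelName Σ ⊎ Fin (suc k)
  ; relArity  = [ relArity Σ , (λ _ → 2) ]′
  ; PredName  = PredName Σ
  ; predArity = predArity Σ
  }

-- In the disjoint union of k + 1 copies of Fin n, the element combine i y
-- is the i-th copy of y; the originals form the copy number zero.
module _ (k : ℕ) where

  original : Fin n → Fin (suc k * n)
  original = combine {suc k} zero

  originals : Subset (suc k * n)
  originals = image original Subset.⊤

  copies : Structure Σ → Structure (copiedVocabulary Σ k)
  copies {Σ} 𝔸 = record
    { size = suc k * size 𝔸
    ; rel  = copiedRel
    ; pred = λ P Xs →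
        does (VecAll.all? (_⊆? originals) Xs)
          ∧ pred 𝔸 P (Vec.map (preimage original) Xs)
    }
    where
    -- On an original element, remainder gives back the element of 𝔸.
    copiedRel : ∀ R → Vec (Fin (suc k * size 𝔸)) (relArity (copiedVocabulary Σ k) R) →
                Bool
    copiedRel (inj₁ R) xs           =
      does (VecAll.all? (_∈? originals) xs)
        ∧ rel 𝔸 R (Vec.map (remainder {suc k} (size 𝔸)) xs)
    copiedRel (inj₂ i) (x ∷ y ∷ []) =
      does (any? λ z → (x ≟ combine i z) ×-dec (y ≟ original z))

record Interpretation (Σ Γ : Vocabulary) : Set where
  field
    domainFormula : Formula Σ 1 0
    relFormula    : (R : RelName Γ) → Formula Σ (relArity Γ R) 0
    predFormula   : (P : PredName Γ) → Formula Σ 0 (predArity Γ P)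

  module _ (𝔸 : Structure Σ) where

    domain : List (Fin (size 𝔸))
    domain = filter (λ x → 𝔸 [ x ∷ [] , [] ]⊨? domainFormula) (allFin (size 𝔸))

    -- The new universe is Fin (length domain), with its elements standing
    -- for the listed elements of 𝔸.
    embed : Fin (length domain) → Fin (size 𝔸)
    embed = List.lookup domain

    interpret : Structure Γ
    interpret = record
      { size = length domain
      ; rel  = λ R xs → does (𝔸 [ Vec.map embed xs , [] ]⊨? relFormula R)
      ; pred = λ P Xs → does (𝔸 [ [] , Vec.map (image embed) Xs ]⊨? predFormula P)
      }

open Interpretation public

Transduction : Vocabulary → Vocabulary → Set₁
Transduction Σ Γ = REL (Structure Σ) (Structure Γ) 0ℓ

data Atomic : Vocabulary → Vocabulary → Set₁ where
  colouring      : (k : ℕ) → Atomic Σ (colouredVocabulary Σ k)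
  copying        : (k : ℕ) → Atomic Σ (copiedVocabulary Σ k)
  filtering      : Sentence Σ → Atomic Σ Σ
  interpretation : Interpretation Σ Γ → Atomic Σ Γ

⟦_⟧ᵃ : Atomic Σ Γ → Transduction Σ Γ
⟦ colouring k ⟧ᵃ      𝔸 𝔹 = ∃ λ c → 𝔹 ≡ colour 𝔸 c
⟦ copying k ⟧ᵃ        𝔸 𝔹 = 𝔹 ≡ copies k 𝔸
⟦ filtering χ ⟧ᵃ      𝔸 𝔹 = (𝔸 [ [] , [] ]⊨ χ) × 𝔹 ≡ 𝔸
⟦ interpretation I ⟧ᵃ 𝔸 𝔹 = 𝔹 ≡ interpret I 𝔸

MSOTransduction : Vocabulary → Vocabulary → Set₁
MSOTransduction = TransClosure Atomic

⟦_⟧ : MSOTransduction Σ Γ → Transduction Σ Γ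
⟦ [ α ]⁺ ⟧ 𝔸 ℂ = ⟦ α ⟧ᵃ 𝔸 ℂ
⟦ α ∷ τ ⟧  𝔸 ℂ = ∃ λ 𝔹 → ⟦ α ⟧ᵃ 𝔸 𝔹 × ⟦ τ ⟧ 𝔹 ℂ

record SetSystem : Set where
  field
    card     : ℕ
    nonEmpty : NonZero card
    family   : Subset card → Bool

  infix 4 _∈𝓕

  _∈𝓕 : Subset card → Set
  X ∈𝓕 = T (family X)

  field
    members-nonempty : ∀ {X} → X ∈𝓕 → Nonempty X

record IsLaminar (S : SetSystem) : Set where
  open SetSystem S
  field
    universe∈𝓕   : Subset.⊤ ∈𝓕
    singleton∈𝓕  : ∀ u → ⁅ u ⁆ ∈𝓕
    intersection : ∀ {X Y} → X ∈𝓕 → Y ∈𝓕 →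
                   X ∩ Y ≡ Subset.⊥ ⊎ X ∩ Y ≡ X ⊎ X ∩ Y ≡ Y

data SetSymbol : Set where
  SET : SetSymbol

setVocabulary : Vocabulary
setVocabulary = record
  { RelName   = ⊥
  ; relArity  = λ ()
  ; PredName  = SetSymbol
  ; predArity = λ { SET → 1 }
  }

setStructure : SetSystem → Structure setVocabulary
setStructure S = record
  { size = card
  ; rel  = λ ()
  ; pred = λ { SET (X ∷ []) → family X }
  }
  where open SetSystem S

record RootedTree : Set where
  field
    order  : ℕ
    root   : Fin order
    parent : Fin order → Maybe (Fin order)

  Vertex : Set
  Vertex = Fin order

  HasParent : Vertex → Vertex → Set
  HasParent x y = parent x ≡ just y

  Descendant : Vertex → Vertex → Set
  Descendant = Star HasParent

  field
    root-orphan : parent root ≡ nothing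
    rooted      : ∀ x → Descendant x root

  descendant? : Decidable Descendant
  descendant? x y = go (rooted x)
    where
    go : ∀ {x} → Descendant x root → Dec (Descendant x y)
    go {x} p with x ≟ y
    go {x} p | yes refl = yes ε
    go ε | no r≢y = no λ
      { ε       → r≢y refl
      ; (q ◅ _) → case trans (sym root-orphan) q of λ () }
    go (p ◅ ps) | no x≢y = map′ (p ◅_)
      (λ { ε        → contradiction refl x≢y
         ; (q ◅ qs) →
             subst (λ z → Descendant z y) (just-injective (trans (sym q) p)) qs })
      (go ps)

data DescSymbol : Set where
  desc : DescSymbol

descVocabulary : Vocabulary
descVocabulary = record
  { RelName   = DescSymbol
  ; relArity  = λ { desc → 2 }
  ; PredName  = ⊥
  ; predArity = λ ()
  }

treeStructure : RootedTree → Structure descVocabulary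
treeStructure T = record
  { size = order
  ; rel  = λ { desc (x ∷ y ∷ []) → does (descendant? x y) }
  ; pred = λ ()
  }
  where open RootedTree T

record LaminarTree (S : SetSystem) : Set where
  open SetSystem S
  field
    tree : RootedTree

  open RootedTree tree public

  field
    nodes : Vertex ⤖ ∃ _∈𝓕

  setOf : Vertex → Subset card
  setOf x = proj₁ (Bijection.to nodes x)

  field
    descendant⇔⊆ : ∀ x y → Descendant x y ⇔ setOf x ⊆ setOf y

-- Every laminar set system has a laminar tree; descendant⇔⊆ determines it
-- up to isomorphism.

allSubsets : ∀ n → List (Subset n)
allSubsets 0       = [] ∷ []
allSubsets (suc n) =
  List.map (inside ∷_) (allSubsets n) List.++ List.map (outside ∷_) (allSubsets n)

∈-allSubsets : (X : Subset n) → X ∈ₗ allSubsets n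
∈-allSubsets []          = ListAny.here refl
∈-allSubsets (true ∷ X)  = ∈-++⁺ˡ (∈-map⁺ _ (∈-allSubsets X))
∈-allSubsets (false ∷ X) = ∈-++⁺ʳ _ (∈-map⁺ _ (∈-allSubsets X))

allSubsets-unique : ∀ n → Unique (allSubsets n)
allSubsets-unique 0       = ListAll.[] ∷ []
allSubsets-unique (suc n) = Unique.++⁺
  (Unique.map⁺ Vecₚ.∷-injectiveʳ (allSubsets-unique n))
  (Unique.map⁺ Vecₚ.∷-injectiveʳ (allSubsets-unique n))
  λ (p , q) → case ∈-map⁻ _ p , ∈-map⁻ _ q of λ
    { ((_ , _ , refl) , (_ , _ , ())) }

lookup-injective : {A : Set} {xs : List A} → Unique xs → ∀ {i j} →
                   List.lookup xs i ≡ List.lookup xs j → i ≡ j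
lookup-injective (_ ∷ _)  {zero}  {zero}  _  = refl
lookup-injective (x∉ ∷ _) {zero}  {suc j} eq = contradiction eq (ListAll.lookup x∉ (∈-lookup j))
lookup-injective (x∉ ∷ _) {suc i} {zero}  eq = contradiction (sym eq) (ListAll.lookup x∉ (∈-lookup i))
lookup-injective (_ ∷ u)  {suc i} {suc j} eq = cong suc (lookup-injective u eq)

⊆⇒≡⊎⊂ : {X Y : Subset n} → X ⊆ Y → X ≡ Y ⊎ X ⊂ Y
⊆⇒≡⊎⊂ {X = X} {Y} X⊆Y with any? (λ x → (x ∈? Y) ×-dec ¬? (x ∈? X))
... | yes new  = inj₂ (X⊆Y , new)
... | no  none = inj₁ (⊆-antisym X⊆Y λ {x} x∈Y →
                   decidable-stable (x ∈? X) λ x∉X → none (x , x∈Y , x∉X))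

module _ (S : SetSystem) (laminar : IsLaminar S) where
  open SetSystem S
  open IsLaminar laminar

  private
    sets : List (Subset card)
    sets = filter (T? ∘ family) (allSubsets card)

    set : Fin (length sets) → Subset card
    set = List.lookup sets

    set∈𝓕 : ∀ x → set x ∈𝓕
    set∈𝓕 x = proj₂ (∈-filter⁻ (T? ∘ family) {xs = allSubsets card} (∈-lookup x))

    set-injective : ∀ {x y} → set x ≡ set y → x ≡ y
    set-injective = lookup-injective (Unique.filter⁺ (T? ∘ family) (allSubsets-unique card))

    index : ∀ {X} → X ∈𝓕 → ∃ λ x → set x ≡ X
    index {X} X∈ = -, sym (lookup-index (∈-filter⁺ (T? ∘ family) (∈-allSubsets X) X∈))

    IsParent : (x y : Fin (length sets)) → Set
    IsParent x y = set x ⊂ set y × (∀ z → set x ⊂ set z → set y ⊆ set z)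

    isParent? : ∀ x → (∃ λ y → IsParent x y) ⊎ ¬ (∃ λ y → IsParent x y)
    isParent? x
      with any? (λ y → (set x ⊂? set y) ×-dec
                       all? λ z → (set x ⊂? set z) →-dec (set y ⊆? set z))
    ... | yes p = inj₁ p
    ... | no ¬p = inj₂ ¬p

    comparable : ∀ x y z → set x ⊂ set y → set x ⊂ set z →
                 set y ⊆ set z ⊎ set z ⊆ set y
    comparable x y z (x⊆y , _) (x⊆z , _) with intersection (set∈𝓕 y) (set∈𝓕 z)
    ... | inj₁ ∩≡⊥        = let u , u∈x = members-nonempty (set∈𝓕 x) in
                            ⊥-elim (∉⊥ (subst (u ∈_) ∩≡⊥ (x∈p∩q⁺ (x⊆y u∈x , x⊆z u∈x))))
    ... | inj₂ (inj₁ ∩≡y) = inj₁ (subst (_⊆ set z) ∩≡y (p∩q⊆q (set y) (set z)))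
    ... | inj₂ (inj₂ ∩≡z) = inj₂ (subst (_⊆ set y) ∩≡z (p∩q⊆p (set y) (set z)))

    parentExists : ∀ x y → set x ⊂ set y → ∃ λ p → IsParent x p
    parentExists x y x⊂y = go y x⊂y (⊂-wellFounded (set y))
      where
      go : ∀ y → set x ⊂ set y → Acc _⊂_ (set y) → ∃ λ p → IsParent x p
      go y x⊂y (acc rec) with any? (λ z → (set x ⊂? set z) ×-dec (set z ⊂? set y))
      ... | yes (z , x⊂z , z⊂y) = go z x⊂z (rec z⊂y)
      ... | no  none            = y , x⊂y , minimal
        where
        minimal : ∀ z → set x ⊂ set z → set y ⊆ set z
        minimal z x⊂z with comparable x y z x⊂y x⊂z
        ... | inj₁ y⊆z = y⊆z
        ... | inj₂ z⊆y with ⊆⇒≡⊎⊂ z⊆y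
        ...   | inj₁ z≡y = subst (_⊆ set z) z≡y ⊆-refl
        ...   | inj₂ z⊂y = contradiction (z , x⊂z , z⊂y) none

    parentOf : Fin (length sets) → Maybe (Fin (length sets))
    parentOf x with isParent? x
    ... | inj₁ (y , _) = just y
    ... | inj₂ _       = nothing

    parentOf-sound : ∀ x {y} → parentOf x ≡ just y → set x ⊂ set y
    parentOf-sound x eq with isParent? x
    parentOf-sound x refl | inj₁ (_ , x⊂y , _) = x⊂y

    parentOf-complete : ∀ x y → set x ⊂ set y →
                        ∃ λ p → parentOf x ≡ just p × IsParent x p
    parentOf-complete x y x⊂y with isParent? x
    ... | inj₁ (p , isP) = p , refl , isP
    ... | inj₂ none      = contradiction (parentExists x y x⊂y) none

    _↝*_ : (x y : Fin (length sets)) → Set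
    _↝*_ = Star λ x y → parentOf x ≡ just y

    ↝*⇒⊆ : ∀ {x y} → x ↝* y → set x ⊆ set y
    ↝*⇒⊆ ε        = ⊆-refl
    ↝*⇒⊆ (p ◅ ps) = ⊆-trans (proj₁ (parentOf-sound _ p)) (↝*⇒⊆ ps)

    ⊆⇒↝* : ∀ x y → set x ⊆ set y → x ↝* y
    ⊆⇒↝* x y = go x (⊃-wellFounded (set x))
      where
      go : ∀ x → Acc Subset._⊃_ (set x) → set x ⊆ set y → x ↝* y
      go x (acc rec) x⊆y with ⊆⇒≡⊎⊂ x⊆y
      ... | inj₁ x≡y = subst (x ↝*_) (set-injective x≡y) ε
      ... | inj₂ x⊂y =
        let p , eq , x⊂p , least = parentOf-complete x y x⊂y in
        eq ◅ go p (rec x⊂p) (least y x⊂y)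

    top : Fin (length sets)
    top = proj₁ (index universe∈𝓕)

    ⊆top : ∀ x → set x ⊆ set top
    ⊆top x = subst (set x ⊆_) (sym (proj₂ (index universe∈𝓕))) ⊆⊤

    top-orphan : parentOf top ≡ nothing
    top-orphan with isParent? top
    ... | inj₁ (y , (_ , u , u∈y , u∉top) , _) = contradiction (⊆top y u∈y) u∉top
    ... | inj₂ _                               = refl

    member-≡ : {X Y : ∃ _∈𝓕} → proj₁ X ≡ proj₁ Y → X ≡ Y
    member-≡ {X , p} {_ , q} refl = cong (X ,_) (T-irrelevant p q)

  laminarTree : LaminarTree S
  laminarTree = record
    { tree = record
      { order       = length sets
      ; root        = top
      ; parent      = parentOf
      ; root-orphan = top-orphan
      ; rooted      = λ x → ⊆⇒↝* x top (⊆top x)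
      }
    ; nodes = mk⤖ {to = λ x → set x , set∈𝓕 x}
        ( (λ eq → set-injective (cong proj₁ eq))
        , strictlySurjective⇒surjective
            (λ (X , X∈) → let x , eq = index X∈ in x , member-≡ eq))
    ; descendant⇔⊆ = λ x y → mk⇔ ↝*⇒⊆ (⊆⇒↝* x y)
    }

{-# OPTIONS --safe #-}
module Submission where

open import Defs
open import Data.Bool.Base using (Bool; true; false; T; not)
import Data.Bool.Properties as Boolₚ
open import Data.Bool.Properties using (T?; T-≡; T-∧; T-irrelevant)
open import Data.Empty using (⊥; ⊥-elim)
open import Data.Fin.Base using (Fin; suc; combine; remainder)
open import Data.Fin.Patterns using (0F; 1F; 2F; 3F; 4F)
open import Data.Fin.Properties
  using (_≟_; any?; all?; remQuot-combine; combine-injective)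
open import Data.Fin.Subset as Subset using (Subset; _∈_; _⊂_; ⁅_⁆)
open import Data.Fin.Subset.Induction using (⊂-wellFounded; ⊃-wellFounded)
open import Data.Fin.Subset.Properties
  using (_∈?_; _⊂?_; anySubset?; ⊆-antisym; ∈⊤; ∉⊥; x∈⁅x⁆; x∈⁅y⁆⇒x≡y;
         p∩q⊆p; p∩q⊆q; x∈p∩q⁺)
open import Data.List.Base using (allFin)
open import Data.List.Membership.Propositional.Properties
  using (∈-filter⁺; ∈-filter⁻; ∈-lookup; ∈-allFin)
import Data.List.Relation.Unary.Any as ListAny
open import Data.List.Relation.Unary.Any.Properties using (lookup-index)
import Data.List.Relation.Unary.Unique.Propositional.Properties as Unique
open import Data.Maybe.Base using (Maybe; just; nothing)
import Data.Maybe.Properties as Maybeₚ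
open import Data.Maybe.Properties using (just-injective)
open import Data.Nat.Base using (ℕ; _*_)
open import Data.Product.Base using (∃; _×_; _,_; proj₁; proj₂)
open import Data.Sum.Base using (_⊎_; inj₁; inj₂; [_,_]′)
open import Data.Vec.Base using (Vec; []; _∷_; lookup; tabulate)
import Data.Vec.Properties as Vecₚ
import Data.Vec.Relation.Unary.All as VecAll
open import Function.Base using (_∘_)
open import Function.Bundles using (_⇔_; mk⇔; mk⤖; module Bijection; module Equivalence)
open import Function.Construct.Composition using (_⇔-∘_)
open import Function.Consequences.Propositional using (strictlySurjective⇒surjective)
open import Induction.WellFounded using (Acc; acc)
open import Relation.Binary.Construct.Closure.Transitive
  using (_∷_) renaming ([_] to [_]⁺)
open import Relation.Binary.PropositionalEquality
  using (_≡_; refl; sym; trans; cong; cong₂; subst)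
open import Relation.Nullary.Decidable
  using (Dec; yes; no; does; dec-true; dec-false; does-⇔; decidable-stable; map′;
         ¬?; _×-dec_; _⊎-dec_; _→-dec_)
open import Relation.Nullary.Negation using (¬_; contradiction)

-- Every inner node G has to be represented by an element of U, injectively
-- and definably from a colouring of U.  Mark one child of every inner node
-- as left, and let G be represented by an element reached by going from G
-- to a child that is not left and then to left children only.  This reduces
-- the problem to making the set of left nodes definable.
--
-- MSO over U can evaluate alternating games: at nodes of even depth all
-- children matter and at nodes of odd depth one child suffices, a leaf being
-- won if it has the colour of the game, and a winning strategy is given by
-- the set of leaves that it reaches.  With four colours A₀, A₁, B₀, B₁, the
-- odd nodes can be made to win exactly one game Aᵢ and one game Bⱼ, the even
-- ones exactly one game: a node winning Aᵢ and Bⱼ has left children winning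
-- Aᵢ and other children winning Bⱼ, a node winning Aᵢ has left children
-- winning Aᵢ, Bᵢ and others winning Aᵢ, B₁₋ᵢ, and dually for Bⱼ.  A node is
-- then left iff, for some i, it wins Aᵢ but not B₁₋ᵢ, whatever its depth.
-- These requirements can be met from the root downwards.
--
-- Colourings that do not represent every inner node exactly once are
-- filtered out, and two copies of U provide the leaves and the inner nodes.

private
  variable
    Σ Γ   : Vocabulary
    e n s : ℕ

-- Formulas for the games and the representation.

ColouredFormula : ℕ → ℕ → Set
ColouredFormula = Formula (colouredVocabulary setVocabulary 5)

infix 7 _⊆̇_ _⊂̇_

_⊆̇_ _⊂̇_ : Fin s → Fin s → ColouredFormula e s
X ⊆̇ Y = ∀ᵉ (0F ∈̇ X ⇒̇ 0F ∈̇ Y)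
X ⊂̇ Y = X ⊆̇ Y ∧̇ ¬̇ (Y ⊆̇ X)

member : Fin s → ColouredFormula e s
member X = predicate SET (X ∷ [])

painted : Fin 5 → Fin e → ColouredFormula e s
painted i x = relation (inj₂ i) (x ∷ [])

meets : Fin s → Fin s → ColouredFormula e s
meets X Y = ∃ᵉ (0F ∈̇ X ∧̇ 0F ∈̇ Y)

child : Fin s → Fin s → ColouredFormula e s
child K H =
  member K ∧̇ member H ∧̇ K ⊂̇ H ∧̇
  ∀ˢ (member 0F ∧̇ suc K ⊆̇ 0F ∧̇ 0F ⊆̇ suc H ⇒̇ 0F ⊆̇ suc K ∨̇ suc H ⊆̇ 0F)

-- For some z ∈ Z, the node H is the least ancestor of G containing z.  In
-- this way Z encodes an arbitrary set of nodes on the path from G to the root.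
marked : Fin s → Fin s → Fin s → ColouredFormula e s
marked Z G H =
  ∃ᵉ (0F ∈̇ Z ∧̇ 0F ∈̇ H ∧̇ ∀ˢ (child 0F (suc H) ∧̇ suc G ⊆̇ 0F ⇒̇ ¬̇ (0F ∈̇ 0F)))

-- The quantified set encodes, through `marked`, a set of ancestors of `G` that contains the root
-- and exactly one of any parent and child. Only the ancestors of even depth form such a set, so the
-- first conjunct asks whether `G` is among them.
evenDepth : Fin s → ColouredFormula e s
evenDepth G = ∃ˢ
  ( marked 0F (suc G) (suc G)
  ∧̇ ∀ˢ (member 0F ∧̇ ∀ᵉ (0F ∈̇ 0F) ⇒̇ marked 1F (suc (suc G)) 0F)
  ∧̇ ∀ˢ (∀ˢ (child 1F 0F ∧̇ suc (suc (suc G)) ⊆̇ 1F ⇒̇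
      (marked 2F (suc (suc (suc G))) 1F ⇒̇ ¬̇ marked 2F (suc (suc (suc G))) 0F)
      ∧̇ (¬̇ marked 2F (suc (suc (suc G))) 1F ⇒̇ marked 2F (suc (suc (suc G))) 0F))))

-- The alternating game below G, in which a player who wants to reach an
-- element of colour i moves at the nodes of odd depth; the set quantified
-- is the set of elements reached by a winning strategy.
wins : Fin 5 → Fin s → ColouredFormula e s
wins i G = ∃ˢ
  ( ∀ᵉ (0F ∈̇ 0F ⇒̇ painted i 0F)
  ∧̇ meets 0F (suc G)
  ∧̇ ∀ˢ (member 0F ∧̇ 0F ⊆̇ suc (suc G) ∧̇ evenDepth 0F ∧̇ meets 1F 0F ⇒̇
      ∀ˢ (child 0F 1F ⇒̇ meets 2F 0F)))

-- The first flag chooses between the games A (`false`) and B (`true`), the second is the index of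
-- the game. Colour `0F` is kept for the representing elements.
side : Bool → Bool → Fin 5
side false false = 1F
side false true  = 2F
side true  false = 3F
side true  true  = 4F

leftNode : Fin s → ColouredFormula e s
leftNode H = (wins (side false false) H ∧̇ ¬̇ wins (side true true) H)
          ∨̇ (wins (side false true) H ∧̇ ¬̇ wins (side true false) H)

path : Fin e → Fin s → ColouredFormula e s
path x G = ∃ˢ
  ( child 0F (suc G) ∧̇ x ∈̇ 0F ∧̇ ¬̇ leftNode 0F
  ∧̇ ∀ˢ (member 0F ∧̇ x ∈̇ 0F ∧̇ 0F ⊂̇ 1F ⇒̇ leftNode 0F))

-- Kind 0 stands for the leaves and kind 1 for the inner nodes.
represents : Fin 2 → Fin e → Fin s → ColouredFormula e s
represents 0F x G = member G ∧̇ x ∈̇ G ∧̇ ∀ᵉ (0F ∈̇ G ⇒̇ 0F ≐ suc x)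
represents 1F x G = painted 0F x ∧̇ path x G

-- A colouring is judged by its effect alone: it passes even if its colours are not those of the
-- intended games, as long as the painted elements name each inner node once.
uniquelyRepresented : ColouredFormula 0 0
uniquelyRepresented = ∀ˢ (∃ˢ (child 0F 1F) ⇒̇
  ∃ᵉ (represents 1F 0F 0F)
  ∧̇ ∀ᵉ (∀ᵉ (represents 1F 0F 0F ∧̇ represents 1F 1F 0F ⇒̇ 0F ≐ 1F)))

-- Inclusion and comprehension of subsets.

-- With its explicit element this is literally the meaning of `_⊆̇_`, so proofs of satisfaction
-- serve as proofs of inclusion and conversely.
_⊑_ : Subset n → Subset n → Set
X ⊑ Y = ∀ x → x ∈ X → x ∈ Y

_⊑?_ : (X Y : Subset n) → Dec (X ⊑ Y)
X ⊑? Y = all? λ x → (x ∈? X) →-dec (x ∈? Y)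

⊑-antisym : {X Y : Subset n} → X ⊑ Y → Y ⊑ X → X ≡ Y
⊑-antisym X⊑Y Y⊑X = ⊆-antisym (λ {x} → X⊑Y x) (λ {x} → Y⊑X x)

⊂⇒⋣ : {X Y : Subset n} → X ⊂ Y → ¬ Y ⊑ X
⊂⇒⋣ (_ , x , x∈Y , x∉X) Y⊑X = x∉X (Y⊑X x x∈Y)

⊑⇒≡⊎⊂ : {X Y : Subset n} → X ⊑ Y → X ≡ Y ⊎ X ⊂ Y
⊑⇒≡⊎⊂ X⊑Y = ⊆⇒≡⊎⊂ (λ {x} → X⊑Y x)

⊑∧⋣⇒⊂ : {X Y : Subset n} → X ⊑ Y → ¬ Y ⊑ X → X ⊂ Y
⊑∧⋣⇒⊂ X⊑Y Y⋢X with ⊑⇒≡⊎⊂ X⊑Y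
... | inj₁ refl = contradiction (λ _ x∈ → x∈) Y⋢X
... | inj₂ X⊂Y  = X⊂Y

⁅⁆-⊑ : {X : Subset n} {x : Fin n} → x ∈ X → ⁅ x ⁆ ⊑ X
⁅⁆-⊑ {X = X} x∈X y y∈ = subst (_∈ X) (sym (x∈⁅y⁆⇒x≡y _ y∈)) x∈X

does⁺ : {P : Set} (P? : Dec P) → P → T (does P?)
does⁺ (yes _) _ = _
does⁺ (no ¬p) p = ¬p p

does⁻ : {P : Set} (P? : Dec P) → T (does P?) → P
does⁻ (yes p) _ = p

⟪_⟫ : {P : Fin n → Set} → (∀ x → Dec (P x)) → Subset n
⟪ P? ⟫ = tabulate (does ∘ P?)

module _ {P : Fin n → Set} (P? : ∀ x → Dec (P x)) {x : Fin n} where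

  ∈-⟪⟫⁺ : P x → x ∈ ⟪ P? ⟫
  ∈-⟪⟫⁺ px = Vecₚ.lookup⇒[]= x ⟪ P? ⟫
    (trans (Vecₚ.lookup∘tabulate (does ∘ P?) x) (dec-true (P? x) px))

  ∈-⟪⟫⁻ : x ∈ ⟪ P? ⟫ → P x
  ∈-⟪⟫⁻ x∈ = does⁻ (P? x) (Equivalence.from T-≡
    (trans (sym (Vecₚ.lookup∘tabulate (does ∘ P?) x)) (Vecₚ.[]=⇒lookup x∈)))

∈⇒T : {X : Subset n} {x : Fin n} → x ∈ X → T (lookup X x)
∈⇒T x∈ = Equivalence.from T-≡ (Vecₚ.[]=⇒lookup x∈)

T⇒∈ : {X : Subset n} {x : Fin n} → T (lookup X x) → x ∈ X
T⇒∈ t = Vecₚ.lookup⇒[]= _ _ (Equivalence.to T-≡ t)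

-- Children and parents in a laminar family.

module Family (S : SetSystem) (laminar : IsLaminar S) where
  open SetSystem S
  open IsLaminar laminar

  paint : (Fin 5 → Subset card) → Structure (colouredVocabulary setVocabulary 5)
  paint = colour {setVocabulary} {5} (setStructure S)

  -- The formula `child` mentions no colour, so its meaning here agrees definitionally with its
  -- meaning under any other colouring.
  plain : Structure (colouredVocabulary setVocabulary 5)
  plain = paint (λ _ → Subset.⊥)

  Child : Subset card → Subset card → Set
  Child K H = plain [ [] , K ∷ H ∷ [] ]⊨ child 0F 1F

  child? : ∀ K H → Dec (Child K H)
  child? K H = plain [ [] , K ∷ H ∷ [] ]⊨? child 0F 1F

  child⇒⊂ : ∀ {K H} → Child K H → K ⊂ H
  child⇒⊂ (_ , _ , (K⊑H , H⋢K) , _) = ⊑∧⋣⇒⊂ K⊑H H⋢K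

  comparable : ∀ {X Y x} → X ∈𝓕 → Y ∈𝓕 → x ∈ X → x ∈ Y → X ⊑ Y ⊎ Y ⊑ X
  comparable {X} {Y} {x} X∈ Y∈ x∈X x∈Y with intersection X∈ Y∈
  ... | inj₁ ∩≡⊥        = contradiction (subst (x ∈_) ∩≡⊥ (x∈p∩q⁺ (x∈X , x∈Y))) ∉⊥
  ... | inj₂ (inj₁ ∩≡X) = inj₁ λ y y∈X → p∩q⊆q X Y (subst (y ∈_) (sym ∩≡X) y∈X)
  ... | inj₂ (inj₂ ∩≡Y) = inj₂ λ y y∈Y → p∩q⊆p X Y (subst (y ∈_) (sym ∩≡Y) y∈Y)

  between? : ∀ K H → Dec (∃ λ J → J ∈𝓕 × K ⊂ J × J ⊂ H)
  between? K H = anySubset? λ J → T? (family J) ×-dec (K ⊂? J) ×-dec (J ⊂? H)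

  cover : ∀ {K H} → K ∈𝓕 → H ∈𝓕 → K ⊂ H → ¬ (∃ λ J → J ∈𝓕 × K ⊂ J × J ⊂ H) → Child K H
  cover {K} {H} K∈ H∈ K⊂H none =
    K∈ , H∈ , ((λ _ → proj₁ K⊂H) , ⊂⇒⋣ K⊂H) , nothingBetween
    where
    nothingBetween : ∀ J → J ∈𝓕 × K ⊑ J × J ⊑ H → J ⊑ K ⊎ H ⊑ J
    nothingBetween J (J∈ , K⊑J , J⊑H) with ⊑⇒≡⊎⊂ K⊑J | ⊑⇒≡⊎⊂ J⊑H
    ... | inj₁ refl | _         = inj₁ λ _ x∈ → x∈
    ... | _         | inj₁ refl = inj₂ λ _ x∈ → x∈
    ... | inj₂ K⊂J  | inj₂ J⊂H  = contradiction (J , J∈ , K⊂J , J⊂H) none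

  childAbove : ∀ {K H} → K ∈𝓕 → H ∈𝓕 → K ⊂ H → ∃ λ J → Child J H × K ⊑ J
  childAbove {K} {H} K∈ H∈ K⊂H = go K K∈ K⊂H (⊃-wellFounded K)
    where
    go : ∀ K → K ∈𝓕 → K ⊂ H → Acc Subset._⊃_ K → ∃ λ J → Child J H × K ⊑ J
    go K K∈ K⊂H (acc rec) with between? K H
    ... | yes (J , J∈ , K⊂J , J⊂H) =
      let L , L-child , J⊑L = go J J∈ J⊂H (rec K⊂J) in
      L , L-child , λ x x∈K → J⊑L x (proj₁ K⊂J x∈K)
    ... | no none = K , cover K∈ H∈ K⊂H none , λ _ x∈ → x∈

  parentOf : ∀ {K} → K ∈𝓕 → K ⊂ Subset.⊤ → ∃ λ H → Child K H
  parentOf {K} K∈ K⊂⊤ = go Subset.⊤ universe∈𝓕 K⊂⊤ (⊂-wellFounded Subset.⊤)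
    where
    go : ∀ H → H ∈𝓕 → K ⊂ H → Acc _⊂_ H → ∃ λ J → Child K J
    go H H∈ K⊂H (acc rec) with between? K H
    ... | yes (J , J∈ , K⊂J , J⊂H) = go J J∈ K⊂J (rec J⊂H)
    ... | no none                  = H , cover K∈ H∈ K⊂H none

  leafOrInner : ∀ {H x} → H ∈𝓕 → x ∈ H → H ≡ ⁅ x ⁆ ⊎ ∃ λ K → Child K H × x ∈ K
  leafOrInner {H} {x} H∈ x∈H with ⊑⇒≡⊎⊂ (⁅⁆-⊑ x∈H)
  ... | inj₁ eq  = inj₁ (sym eq)
  ... | inj₂ x⊂H =
    let K , K-child , x⊑K = childAbove (singleton∈𝓕 x) H∈ x⊂H in
    inj₂ (K , K-child , x⊑K x (x∈⁅x⁆ x))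

  -- Two parents share an element of `K`, hence are comparable. The smaller one lies between `K` and
  -- the larger one and differs from `K`, so it is the larger one.
  parent-unique : ∀ {K H J} → Child K H → Child K J → H ≡ J
  parent-unique {K} {H} {J} (K∈ , H∈ , (K⊑H , H⋢K) , leastH) (_ , J∈ , (K⊑J , J⋢K) , leastJ)
    with members-nonempty K∈
  ... | x , x∈K with comparable H∈ J∈ (K⊑H x x∈K) (K⊑J x x∈K)
  ...   | inj₁ H⊑J with leastJ H (H∈ , K⊑H , H⊑J)
  ...     | inj₁ H⊑K = contradiction H⊑K H⋢K
  ...     | inj₂ J⊑H = ⊑-antisym H⊑J J⊑H
  parent-unique {K} {H} {J} (K∈ , H∈ , (K⊑H , H⋢K) , leastH) (_ , J∈ , (K⊑J , J⋢K) , leastJ)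
      | x , x∈K | inj₂ J⊑H with leastH J (J∈ , K⊑J , J⊑H)
  ...     | inj₁ J⊑K = contradiction J⊑K J⋢K
  ...     | inj₂ H⊑J = ⊑-antisym H⊑J J⊑H

  meets-child : ∀ {K H J x} → Child K H → J ∈𝓕 → J ⊑ H → x ∈ K → x ∈ J → J ≡ H ⊎ J ⊑ K
  meets-child (K∈ , _ , _ , least) J∈ J⊑H x∈K x∈J with comparable J∈ K∈ x∈J x∈K
  ... | inj₁ J⊑K = inj₂ J⊑K
  ... | inj₂ K⊑J with least _ (J∈ , K⊑J , J⊑H)
  ...   | inj₁ J⊑K = inj₂ J⊑K
  ...   | inj₂ H⊑J = inj₁ (⊑-antisym J⊑H H⊑J)

  siblings-disjoint : ∀ {K K′ H x} → Child K H → Child K′ H → x ∈ K → x ∈ K′ → K ≡ K′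
  siblings-disjoint ch@(K∈ , _ , (K⊑H , H⋢K) , _) ch′@(K′∈ , _ , (K′⊑H , H⋢K′) , _) x∈K x∈K′
    with meets-child ch K′∈ K′⊑H x∈K x∈K′ | meets-child ch′ K∈ K⊑H x∈K′ x∈K
  ... | inj₂ K′⊑K | inj₂ K⊑K′ = ⊑-antisym K⊑K′ K′⊑K
  ... | inj₁ refl | _         = contradiction (λ _ x∈ → x∈) H⋢K′
  ... | _         | inj₁ refl = contradiction (λ _ x∈ → x∈) H⋢K

  singleton-childless : ∀ {K x} → ¬ Child K ⁅ x ⁆
  singleton-childless {K} {x} (K∈ , _ , (K⊑x , x⋢K) , _) with members-nonempty K∈
  ... | y , y∈K with refl ← x∈⁅y⁆⇒x≡y x (K⊑x y y∈K) = x⋢K (⁅⁆-⊑ y∈K)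

  -- Repeated use of `next` leads from `K` down to a singleton. By `meets-child`, a member below `K`
  -- that contains its element is one of the nodes visited. This yields both leaves reached by
  -- winning strategies and paths of left children.
  descend : {P : Subset card → Set} →
            (∀ {H K} → P H → Child K H → ∃ λ J → Child J H × P J) →
            ∀ {K} → K ∈𝓕 → P K → ∃ λ x → x ∈ K × (∀ H → H ∈𝓕 → x ∈ H → H ⊑ K → P H)
  descend {P} next {K} K∈ pK = go K K∈ pK (⊂-wellFounded K)
    where
    go : ∀ K → K ∈𝓕 → P K → Acc _⊂_ K →
         ∃ λ x → x ∈ K × (∀ H → H ∈𝓕 → x ∈ H → H ⊑ K → P H)
    go K K∈ pK (acc rec) with members-nonempty K∈
    ... | u , u∈K with leafOrInner K∈ u∈K
    ...   | inj₁ refl = u , u∈K , λ H H∈ u∈H H⊑u →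
              subst P (⊑-antisym (⁅⁆-⊑ u∈H) H⊑u) pK
    ...   | inj₂ (L , L-child , _) =
      let J , J-child , pJ = next pK L-child
          x , x∈J , below  = go J (proj₁ J-child) pJ (rec (child⇒⊂ J-child)) in
      x , proj₁ (child⇒⊂ J-child) x∈J , λ H H∈ x∈H H⊑K →
        [ (λ H≡K → subst P (sym H≡K) pK) , below H H∈ x∈H ]′
          (meets-child J-child H∈ H⊑K x∈J x∈H)

  parent? : ∀ K → Dec (∃ λ H → Child K H)
  parent? K = anySubset? (child? K)

  -- Recursion from the root downwards: it is well founded along proper supersets, and
  -- `parent-unique` identifies the parent found by search with any given one.
  module Labelling {Q : Set} (q₀ : Q) (next : Subset card → Subset card → Q → Q) where

    labelAcc : ∀ K → Acc Subset._⊃_ K → Q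
    labelAcc K (acc rec) with parent? K
    ... | yes (H , K-child) = next H K (labelAcc H (rec (child⇒⊂ K-child)))
    ... | no _              = q₀

    labelAcc-irrelevant : ∀ K (a b : Acc Subset._⊃_ K) → labelAcc K a ≡ labelAcc K b
    labelAcc-irrelevant K (acc rec) (acc rec′) with parent? K
    ... | yes (H , K-child) = cong (next H K)
            (labelAcc-irrelevant H (rec (child⇒⊂ K-child)) (rec′ (child⇒⊂ K-child)))
    ... | no _        = refl

    abstract
      label : Subset card → Q
      label K = labelAcc K (⊃-wellFounded K)

      label-root : label Subset.⊤ ≡ q₀
      label-root = go (⊃-wellFounded Subset.⊤)
        where
        go : (a : Acc Subset._⊃_ Subset.⊤) → labelAcc Subset.⊤ a ≡ q₀
        go (acc _) with parent? Subset.⊤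
        ... | yes (_ , _ , _ , (_ , H⋢⊤) , _) = contradiction (λ _ _ → ∈⊤) H⋢⊤
        ... | no _                            = refl

      label-child : ∀ {K H} → Child K H → label K ≡ next H K (label H)
      label-child {K} {H} K-child = go (⊃-wellFounded K)
        where
        go : (a : Acc Subset._⊃_ K) → labelAcc K a ≡ next H K (label H)
        go (acc rec) with parent? K
        ... | yes (J , K-childJ) with refl ← parent-unique K-child K-childJ =
                cong (next H K)
                  (labelAcc-irrelevant H (rec (child⇒⊂ K-childJ)) (⊃-wellFounded H))
        ... | no none = contradiction (H , K-child) none

-- States of nodes and the local rules of the games.

_==_ : Bool → Bool → Bool
true  == b = b
false == b = not b

==-refl : ∀ b → T (b == b)
==-refl true  = _
==-refl false = _

not-== : ∀ b c → T (b == c) → T (not b == not c)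
not-== true  true  t = t
not-== false false t = t

==-not : ∀ b c → T (not b == c) → T (b == not c)
==-not true  false t = t
==-not false true  t = t

==-exclusive : ∀ b c → T (b == c) → ¬ T (not b == c)
==-exclusive true  true  _ ()
==-exclusive false false _ ()

¬==-not : ∀ b → ¬ T (b == not b)
¬==-not true  ()
¬==-not false ()

-- The value of the four games at a node. At an even node exactly one of
-- them is won, at an odd node one on each side.
data State : Set where
  one two : Bool → Bool → State

won : State → Bool → Bool → Bool
won (one false i) false c = i == c
won (one false i) true  c = false
won (one true  j) false c = false
won (one true  j) true  c = j == c
won (two i j)     false c = i == c
won (two i j)     true  c = j == c

-- The state of a child, the flag telling whether it is a left one.
step : State → Bool → State
step (two i j)     true  = one false i
step (two i j)     false = one true j
step (one s i)     true  = two i i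
step (one false i) false = two i (not i)
step (one true j)  false = two (not j) j

isEven : State → Bool
isEven (one _ _) = true
isEven (two _ _) = false

isEven-step : ∀ q l → isEven (step q l) ≡ not (isEven q)
isEven-step (one s     i) true  = refl
isEven-step (one false i) false = refl
isEven-step (one true  i) false = refl
isEven-step (two i j)     true  = refl
isEven-step (two i j)     false = refl

won-every : ∀ q l d c → T (isEven q) → T (won q d c) → T (won (step q l) d c)
won-every (one false i) true  false c _ t = t
won-every (one false i) false false c _ t = t
won-every (one true  j) true  true  c _ t = t
won-every (one true  j) false true  c _ t = t

-- On the side where an even state wins nothing, its two kinds of children win opposite indices, so
-- no game of that side is won by both.
every-won : ∀ q d c → T (isEven q) → (∀ l → T (won (step q l) d c)) → T (won q d c)
every-won (one false i) false c _ t = t true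
every-won (one false i) true  c _ t = ⊥-elim (==-exclusive i c (t true) (t false))
every-won (one true  j) false c _ t = ⊥-elim (==-exclusive j c (t true) (t false))
every-won (one true  j) true  c _ t = t true

some-won : ∀ q l d c → ¬ T (isEven q) → T (won (step q l) d c) → T (won q d c)
some-won (one _ _) l     d     c odd t = contradiction _ odd
some-won (two i j) true  false c odd t = t
some-won (two i j) false true  c odd t = t

won-some : ∀ q d c → T (won q d c) → ∃ λ l → T (won (step q l) d c)
won-some (one s i) d     c t = true , won-every (one s i) true d c _ t
won-some (two i j) false c t = true , t
won-some (two i j) true  c t = false , t

Left : State → Set
Left q = ∃ λ c → T (won q false c) × ¬ T (won q true (not c))

left? : ∀ q → Dec (Left q)
left? q = map′
  (λ { (inj₁ p) → false , p ; (inj₂ p) → true , p })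
  (λ { (false , p) → inj₁ p ; (true , p) → inj₂ p })
  ((T? _ ×-dec ¬? (T? _)) ⊎-dec (T? _ ×-dec ¬? (T? _)))

Left-step : ∀ q → Left (step q true)
Left-step (one s i) = i , ==-refl i , ¬==-not i
Left-step (two i j) = i , ==-refl i , λ ()

-- A child in state `two i j` that is not left has `j` equal to `not i`, so winning Aᵢ comes with
-- winning B₁₋ᵢ. One in state `one true j` wins no game A.
¬Left-step : ∀ q → ¬ Left (step q false)
¬Left-step (one false i) (c , t , ¬t) = ¬t (not-== i c t)
¬Left-step (one true  j) (c , t , ¬t) = ¬t (==-not j c t)
¬Left-step (two i j)     (c , () , _)

-- The games agree with the states.

module Games (S : SetSystem) (laminar : IsLaminar S) where
  open SetSystem S
  open IsLaminar laminar
  open Family S laminar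

  -- Whichever child this search finds is declared to be the left one.
  leftChild? : ∀ H → Dec (∃ λ K → Child K H)
  leftChild? H = anySubset? λ K → child? K H

  isLeft : Subset card → Subset card → Bool
  isLeft H K with leftChild? H
  ... | yes (L , _) = does (Vecₚ.≡-dec Boolₚ._≟_ L K)
  ... | no _        = false

  -- The left child `L` is a proper subset of `H`, and as singletons are members, an element of `H`
  -- outside `L` lies in another child.
  hasBothChildren : ∀ {K H} → Child K H → ∀ l → ∃ λ J → Child J H × isLeft H J ≡ l
  hasBothChildren {K} {H} K-child true with leftChild? H
  ... | yes (L , L-child) = L , L-child , dec-true (Vecₚ.≡-dec Boolₚ._≟_ L L) refl
  ... | no none           = contradiction (K , K-child) none
  hasBothChildren {K} {H} K-child false with leftChild? H
  ... | no none           = contradiction (K , K-child) none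
  ... | yes (L , L-child) with child⇒⊂ L-child
  ...   | _ , x , x∈H , x∉L with leafOrInner (proj₁ (proj₂ K-child)) x∈H
  ...     | inj₁ refl = contradiction K-child singleton-childless
  ...     | inj₂ (J , J-child , x∈J) =
    J , J-child , dec-false (Vecₚ.≡-dec Boolₚ._≟_ L J) λ { refl → x∉L x∈J }

  -- The root has depth zero, so it gets an even state; the choice among these is arbitrary.
  open Labelling (one false false) (λ H K q → step q (isLeft H K))
    renaming (label to state; label-root to state-root; label-child to state-child) public

  childState : ∀ {K H} → Child K H → ∀ l → ∃ λ J → Child J H × state J ≡ step (state H) l
  childState {H = H} K-child l with hasBothChildren K-child l
  ... | J , J-child , eq =
    J , J-child , trans (state-child J-child) (cong (step (state H)) eq)

  Even : Subset card → Set
  Even H = T (isEven (state H))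

  Even-root : Even Subset.⊤
  Even-root = subst (T ∘ isEven) (sym state-root) _

  ¬Even-child : ∀ {K H} → Child K H → Even K → ¬ Even H
  ¬Even-child {K} {H} K-child evenK evenH
    rewrite state-child K-child | isEven-step (state H) (isLeft H K)
    with isEven (state H)
  ... | true = evenK

  Even-child : ∀ {K H} → Child K H → ¬ Even K → Even H
  Even-child {K} {H} K-child oddK
    rewrite state-child K-child | isEven-step (state H) (isLeft H K)
    with isEven (state H)
  ... | true  = _
  ... | false = oddK _

  Meets : Subset card → Subset card → Set
  Meets X Y = ∃ λ x → x ∈ X × x ∈ Y

  module Evaluation (c : Fin 5 → Subset card) where

    EvenDepth : Subset card → Set
    EvenDepth G = paint c [ [] , G ∷ [] ]⊨ evenDepth 0F

    -- H is the least ancestor of G containing z.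
    Joins : Subset card → Subset card → Fin card → Set
    Joins G H z = z ∈ H × (∀ K → Child K H × G ⊑ K → ¬ (z ∈ K))

    -- If one were properly below the other, the child of the larger one above the smaller one would
    -- contain both `G` and `z`.
    joins-unique : ∀ {G H J z} → G ∈𝓕 → H ∈𝓕 → J ∈𝓕 → G ⊑ H → G ⊑ J →
                   Joins G H z → Joins G J z → H ≡ J
    joins-unique {G} {H} {J} {z} G∈ H∈ J∈ G⊑H G⊑J (z∈H , noneH) (z∈J , noneJ)
      with comparable H∈ J∈ z∈H z∈J
    ... | inj₁ H⊑J with ⊑⇒≡⊎⊂ H⊑J
    ...   | inj₁ H≡J = H≡J
    ...   | inj₂ H⊂J with childAbove H∈ J∈ H⊂J
    ...     | K , K-child , H⊑K =
      contradiction (H⊑K z z∈H) (noneJ K (K-child , λ x x∈ → H⊑K x (G⊑H x x∈)))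
    joins-unique {G} {H} {J} {z} G∈ H∈ J∈ G⊑H G⊑J (z∈H , noneH) (z∈J , noneJ)
        | inj₂ J⊑H with ⊑⇒≡⊎⊂ J⊑H
    ...   | inj₁ J≡H = sym J≡H
    ...   | inj₂ J⊂H with childAbove J∈ H∈ J⊂H
    ...     | K , K-child , J⊑K =
      contradiction (J⊑K z z∈J) (noneH K (K-child , λ x x∈ → J⊑K x (G⊑J x x∈)))

    -- For `H` equal to `G` any element serves. Otherwise an element of `H` outside the child `L`
    -- above `G` does, since no sibling of `L` contains `G`.
    joins-exists : ∀ {G H} → G ∈𝓕 → H ∈𝓕 → G ⊑ H → ∃ λ z → Joins G H z
    joins-exists {G} {H} G∈ H∈ G⊑H with members-nonempty G∈ | ⊑⇒≡⊎⊂ G⊑H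
    ... | x , x∈G | inj₁ refl =
      x , x∈G , λ K (K-child , G⊑K) _ → ⊂⇒⋣ (child⇒⊂ K-child) G⊑K
    ... | x , x∈G | inj₂ G⊂H with childAbove G∈ H∈ G⊂H
    ...   | L , L-child , G⊑L with child⇒⊂ L-child
    ...     | _ , z , z∈H , z∉L = z , z∈H , λ K (K-child , G⊑K) z∈K →
      z∉L (subst (z ∈_) (siblings-disjoint K-child L-child (G⊑K x x∈G) (G⊑L x x∈G)) z∈K)

    -- By induction from the root down to `G`, an ancestor is marked iff it is even: both properties
    -- hold at the root and flip from parent to child.
    evenDepth⇒Even : ∀ {G} → G ∈𝓕 → EvenDepth G → Even G
    evenDepth⇒Even {G} G∈ (Z , markedG , atRoot , alternating) =
      proj₁ (agrees G G∈ (λ _ x∈ → x∈) (⊃-wellFounded G)) markedG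
      where
      Marked : Subset card → Set
      Marked H = paint c [ [] , Z ∷ G ∷ H ∷ [] ]⊨ marked 0F 1F 2F

      agrees : ∀ H → H ∈𝓕 → G ⊑ H → Acc Subset._⊃_ H →
               (Marked H → Even H) × (Even H → Marked H)
      agrees H H∈ G⊑H (acc rec) with ⊑⇒≡⊎⊂ {X = H} {Y = Subset.⊤} (λ _ _ → ∈⊤)
      ... | inj₁ refl = (λ _ → Even-root) , λ _ → atRoot H (H∈ , λ _ → ∈⊤)
      ... | inj₂ H⊂⊤ with parentOf H∈ H⊂⊤
      ...   | J , H-child
        with agrees J (proj₁ (proj₂ H-child)) (λ x x∈ → proj₁ (child⇒⊂ H-child) (G⊑H x x∈))
               (rec (child⇒⊂ H-child))
           | alternating H J (H-child , G⊑H)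
      ...     | m⇒e , e⇒m | m⇒¬m , ¬m⇒m =
        (λ m → decidable-stable (T? _) λ odd → m⇒¬m m (e⇒m (Even-child H-child odd))) ,
        (λ even → decidable-stable (paint c [ [] , Z ∷ G ∷ H ∷ [] ]⊨? marked 0F 1F 2F)
          λ ¬m → ¬Even-child H-child even (m⇒e (¬m⇒m ¬m)))

    -- `Z` collects the elements whose join with `G` is even. Since every ancestor is the join of
    -- some element and joins are unique, `Z` marks exactly the even ancestors.
    Even⇒evenDepth : ∀ {G} → G ∈𝓕 → Even G → EvenDepth G
    Even⇒evenDepth {G} G∈ evenG =
      Z , even⇒marked G∈ (λ _ x∈ → x∈) evenG ,
      (λ H (H∈ , full) → even⇒marked H∈ (λ x _ → full x)
        (subst Even (⊑-antisym (λ x _ → full x) (λ _ _ → ∈⊤)) Even-root)) ,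
      λ H J (H-child , G⊑H) →
        let H∈  = proj₁ H-child
            J∈  = proj₁ (proj₂ H-child)
            G⊑J = λ x x∈ → proj₁ (child⇒⊂ H-child) (G⊑H x x∈) in
        (λ mH mJ → ¬Even-child H-child (marked⇒even H∈ G⊑H mH) (marked⇒even J∈ G⊑J mJ)) ,
        (λ ¬mH → even⇒marked J∈ G⊑J
          (Even-child H-child λ evenH → ¬mH (even⇒marked H∈ G⊑H evenH)))
      where
      joins? : ∀ H z → Dec (Joins G H z)
      joins? H z = (z ∈? H) ×-dec allSubset? λ K →
        (child? K H ×-dec G ⊑? K) →-dec ¬? (z ∈? K)

      evenJoin? : ∀ z → Dec (∃ λ H → H ∈𝓕 × G ⊑ H × Joins G H z × Even H)
      evenJoin? z = anySubset? λ H → T? (family H) ×-dec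
        (G ⊑? H) ×-dec joins? H z ×-dec T? _

      Z : Subset card
      Z = ⟪ evenJoin? ⟫

      Marked : Subset card → Set
      Marked H = paint c [ [] , Z ∷ G ∷ H ∷ [] ]⊨ marked 0F 1F 2F

      even⇒marked : ∀ {H} → H ∈𝓕 → G ⊑ H → Even H → Marked H
      even⇒marked {H} H∈ G⊑H evenH =
        let z , joins = joins-exists G∈ H∈ G⊑H in
        z , ∈-⟪⟫⁺ evenJoin? (H , H∈ , G⊑H , joins , evenH) , joins

      marked⇒even : ∀ {H} → H ∈𝓕 → G ⊑ H → Marked H → Even H
      marked⇒even H∈ G⊑H (z , z∈Z , joins) =
        let J , J∈ , G⊑J , joinsJ , evenJ = ∈-⟪⟫⁻ evenJoin? z∈Z in
        subst Even (joins-unique G∈ J∈ H∈ G⊑J G⊑H joinsJ joins) evenJ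

    Wins : Fin 5 → Subset card → Set
    Wins i G = paint c [ [] , G ∷ [] ]⊨ wins i 0F

    module _ {d b : Bool}
      (shows : ∀ x → T (won (state ⁅ x ⁆) d b) → T (lookup (c (side d b)) x))
      (shown : ∀ x → T (lookup (c (side d b)) x) → T (won (state ⁅ x ⁆) d b)) where

      Won : Subset card → Set
      Won H = T (won (state H) d b)

      -- Every node below `G` that meets the strategy `X` is won, by induction from the leaves,
      -- where `X` has the colour of the game.
      wins⇒Won : ∀ {G} → G ∈𝓕 → Wins (side d b) G → Won G
      wins⇒Won {G} G∈ (X , X-coloured , X-meets , every) =
        go G G∈ (λ _ x∈ → x∈) X-meets (⊂-wellFounded G)
        where
        go : ∀ H → H ∈𝓕 → H ⊑ G → Meets X H → Acc _⊂_ H → Won H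
        go H H∈ H⊑G meets@(x , x∈X , x∈H) (acc rec) with leafOrInner H∈ x∈H
        ... | inj₁ refl = shown x (X-coloured x x∈X)
        ... | inj₂ (K , K-child , x∈K) with T? (isEven (state H))
        -- At an odd node one won child suffices, and the child `K` containing `x` meets `X`.
        ...   | no odd = some-won (state H) (isLeft H K) d b odd
                  (subst (λ q → T (won q d b)) (state-child K-child)
                    (go K (proj₁ K-child) (λ y y∈ → H⊑G y (proj₁ (child⇒⊂ K-child) y∈))
                      (x , x∈X , x∈K) (rec (child⇒⊂ K-child))))
        -- At an even node `X` meets all children, in particular one of each kind.
        ...   | yes even = every-won (state H) d b even λ l →
          let J , J-child , eq = childState K-child l in
          subst (λ q → T (won q d b)) eq
            (go J (proj₁ J-child) (λ y y∈ → H⊑G y (proj₁ (child⇒⊂ J-child) y∈))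
              (every H (H∈ , H⊑G , Even⇒evenDepth H∈ even , meets) J J-child)
              (rec (child⇒⊂ J-child)))

      Won-next : ∀ {H K} → Won H → Child K H → ∃ λ J → Child J H × Won J
      Won-next {H} wonH K-child =
        let l , t            = won-some (state H) d b wonH
            J , J-child , eq = childState K-child l in
        J , J-child , subst (λ q → T (won q d b)) (sym eq) t

      -- The strategy is the set of all elements of `G` such that every member containing them, up
      -- to `G`, is won.
      Won⇒wins : ∀ {G} → G ∈𝓕 → Won G → Wins (side d b) G
      Won⇒wins {G} G∈ wonG =
        X ,
        (λ x x∈X → let x∈G , upward = ∈-⟪⟫⁻ strategy? x∈X in
          shows x (upward ⁅ x ⁆ (singleton∈𝓕 x , x∈⁅x⁆ x , ⁅⁆-⊑ x∈G))) ,
        reach G∈ (λ _ x∈ → x∈) wonG (λ H _ G⊑H H⊑G → subst Won (⊑-antisym G⊑H H⊑G) wonG) ,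
        λ H (H∈ , H⊑G , even , x , x∈X , x∈H) K K-child →
          let K∈ = proj₁ K-child
              K⊑H = λ y y∈ → proj₁ (child⇒⊂ K-child) y∈
              upward = proj₂ (∈-⟪⟫⁻ strategy? x∈X)
              wonH = upward H (H∈ , x∈H , H⊑G)
              wonK = subst (λ q → T (won q d b)) (sym (state-child K-child)) (won-every
                       (state H) (isLeft H K) d b (evenDepth⇒Even H∈ even) wonH) in
          reach K∈ (λ y y∈ → H⊑G y (K⊑H y y∈)) wonK (above K-child wonK upward x∈H)
        where
        strategy? : ∀ x → Dec (x ∈ G × (∀ H → H ∈𝓕 × x ∈ H × H ⊑ G → Won H))
        strategy? x = (x ∈? G) ×-dec allSubset? λ H →
          (T? (family H) ×-dec (x ∈? H) ×-dec (H ⊑? G)) →-dec T? _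

        X : Subset card
        X = ⟪ strategy? ⟫

        -- A member between `K` and `G` is either `K` itself or contains `H`, hence `x`, and is then
        -- won because `x` belongs to the strategy.
        above : ∀ {H K x} → Child K H → Won K →
                (∀ J → J ∈𝓕 × x ∈ J × J ⊑ G → Won J) → x ∈ H →
                ∀ J → J ∈𝓕 → K ⊑ J → J ⊑ G → Won J
        above {H} {K} {x} K-child@(K∈ , H∈ , (K⊑H , _) , least) wonK upward x∈H J J∈ K⊑J J⊑G
          with members-nonempty K∈
        ... | u , u∈K with comparable H∈ J∈ (K⊑H u u∈K) (K⊑J u u∈K)
        ...   | inj₁ H⊑J = upward J (J∈ , H⊑J x x∈H , J⊑G)
        ...   | inj₂ J⊑H with least J (J∈ , K⊑J , J⊑H)
        ...     | inj₁ J⊑K = subst Won (⊑-antisym K⊑J J⊑K) wonK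
        ...     | inj₂ H⊑J = upward J (J∈ , H⊑J x x∈H , J⊑G)

        -- Descending from `K` through won children gives an element that is good for the members
        -- below `K`; `higher` takes care of those above.
        reach : ∀ {K} → K ∈𝓕 → K ⊑ G → Won K →
                (∀ J → J ∈𝓕 → K ⊑ J → J ⊑ G → Won J) → Meets X K
        reach {K} K∈ K⊑G wonK higher =
          let u , u∈K , lower = descend Won-next K∈ wonK in
          u , ∈-⟪⟫⁺ strategy? (K⊑G u u∈K , λ J (J∈ , u∈J , J⊑G) →
            [ lower J J∈ u∈J , (λ K⊑J → higher J J∈ K⊑J J⊑G) ]′
              (comparable J∈ K∈ u∈J u∈K)) ,
          u∈K

-- A colouring that passes the filter.

witness : {A : Set} {P : A → Set} → Dec (∃ P) → Maybe A
witness (yes (x , _)) = just x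
witness (no _)        = nothing

witness-sound : {A : Set} {P : A → Set} (P? : Dec (∃ P)) {x : A} → witness P? ≡ just x → P x
witness-sound (yes (_ , p)) refl = p

witness-complete : {A : Set} {P : A → Set} (P? : Dec (∃ P)) →
                   ∃ P → ∃ λ x → witness P? ≡ just x
witness-complete (yes (x , _)) _ = x , refl
witness-complete (no none)     p = contradiction p none

module Representation (S : SetSystem) (laminar : IsLaminar S) where
  open SetSystem S
  open Family S laminar
  open Games S laminar

  module _ (c : Fin 5 → Subset card) where

    Path : Fin card → Subset card → Set
    Path x G = paint c [ x ∷ [] , G ∷ [] ]⊨ path 0F 0F

    -- The child in the path is the least member containing `x` that is not left, so `x` determines
    -- it and its parent. This holds for every colouring, as it must, because the filter may let
    -- unintended ones pass.
    path-functional : ∀ {x G H} → Path x G → Path x H → G ≡ H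
    path-functional (K , K-child , x∈K , K-right , below)
                    (J , J-child , x∈J , J-right , below′)
      with comparable (proj₁ K-child) (proj₁ J-child) x∈K x∈J
    ... | inj₁ K⊑J with ⊑⇒≡⊎⊂ K⊑J
    ...   | inj₁ refl = parent-unique K-child J-child
    ...   | inj₂ K⊂J  =
              contradiction (below′ K (proj₁ K-child , x∈K , K⊑J , ⊂⇒⋣ K⊂J)) K-right
    path-functional (K , K-child , x∈K , K-right , below)
                    (J , J-child , x∈J , J-right , below′)
        | inj₂ J⊑K with ⊑⇒≡⊎⊂ J⊑K
    ...   | inj₁ refl = parent-unique K-child J-child
    ...   | inj₂ J⊂K  =
              contradiction (below J (proj₁ J-child , x∈J , J⊑K , ⊂⇒⋣ J⊂K)) J-right

  -- The counterpart of `Path` in terms of states. It depends on no colouring, so representatives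
  -- can be chosen before colour `0F` is fixed.
  LeftPath : Fin card → Subset card → Set
  LeftPath x G = ∃ λ K → Child K G × x ∈ K × ¬ Left (state K) ×
    (∀ H → H ∈𝓕 × x ∈ H × H ⊑ K × ¬ K ⊑ H → Left (state H))

  leftPath? : ∀ x G → Dec (LeftPath x G)
  leftPath? x G = anySubset? λ K →
    child? K G ×-dec (x ∈? K) ×-dec ¬? (left? (state K)) ×-dec
    allSubset? λ H → (T? (family H) ×-dec (x ∈? H) ×-dec (H ⊑? K) ×-dec ¬? (K ⊑? H))
      →-dec left? (state H)

  leftPath-exists : ∀ {K G} → Child K G → ∃ λ x → LeftPath x G
  leftPath-exists {K} {G} K-child =
    let L , L-child , right = childState K-child false
        -- The descent starts at `L`, which is not left itself; the first disjunct makes room for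
        -- it.
        x , x∈L , below     = descend {P = λ H → H ≡ L ⊎ Left (state H)} next
                                (proj₁ L-child) (inj₁ refl) in
    x , L , L-child , x∈L ,
    (λ left → ¬Left-step (state G) (subst Left right left)) ,
    λ H (H∈ , x∈H , H⊑L , L⋢H) → proper (below H H∈ x∈H H⊑L) L⋢H
    where
    next : ∀ {L H J} → H ≡ L ⊎ Left (state H) → Child J H →
           ∃ λ M → Child M H × (M ≡ L ⊎ Left (state M))
    next {H = H} _ J-child =
      let M , M-child , left = childState J-child true in
      M , M-child , inj₂ (subst Left (sym left) (Left-step (state H)))

    proper : ∀ {H L} → H ≡ L ⊎ Left (state H) → ¬ L ⊑ H → Left (state H)
    proper (inj₁ refl) L⋢L = contradiction (λ _ x∈ → x∈) L⋢L
    proper (inj₂ left) _   = left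

  winners : Bool → Bool → Subset card
  winners d b = ⟪ (λ x → T? (won (state ⁅ x ⁆) d b)) ⟫

  palette : Subset card → Fin 5 → Subset card
  palette R 0F = R
  palette R 1F = winners false false
  palette R 2F = winners false true
  palette R 3F = winners true false
  palette R 4F = winners true true

  palette-side : ∀ R d b → palette R (side d b) ≡ winners d b
  palette-side R false false = refl
  palette-side R false true  = refl
  palette-side R true  false = refl
  palette-side R true  true  = refl

  module _ (R : Subset card) where
    open Evaluation (palette R)

    shows : ∀ d b x → T (won (state ⁅ x ⁆) d b) → T (lookup (palette R (side d b)) x)
    shows d b x t rewrite palette-side R d b =
      ∈⇒T (∈-⟪⟫⁺ (λ x → T? (won (state ⁅ x ⁆) d b)) t)

    shown : ∀ d b x → T (lookup (palette R (side d b)) x) → T (won (state ⁅ x ⁆) d b)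
    shown d b x t rewrite palette-side R d b =
      ∈-⟪⟫⁻ (λ x → T? (won (state ⁅ x ⁆) d b)) (T⇒∈ t)

    wins⇒won : ∀ d b {G} → G ∈𝓕 → Wins (side d b) G → T (won (state G) d b)
    wins⇒won d b = wins⇒Won (shows d b) (shown d b)

    won⇒wins : ∀ d b {G} → G ∈𝓕 → T (won (state G) d b) → Wins (side d b) G
    won⇒wins d b = Won⇒wins (shows d b) (shown d b)

    LeftNode : Subset card → Set
    LeftNode G = paint (palette R) [ [] , G ∷ [] ]⊨ leftNode 0F

    leftNode⇒Left : ∀ {G} → G ∈𝓕 → LeftNode G → Left (state G)
    leftNode⇒Left G∈ (inj₁ (w , ¬w)) =
      false , wins⇒won false false G∈ w , λ t → ¬w (won⇒wins true true G∈ t)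
    leftNode⇒Left G∈ (inj₂ (w , ¬w)) =
      true , wins⇒won false true G∈ w , λ t → ¬w (won⇒wins true false G∈ t)

    Left⇒leftNode : ∀ {G} → G ∈𝓕 → Left (state G) → LeftNode G
    Left⇒leftNode G∈ (false , t , ¬t) =
      inj₁ (won⇒wins false false G∈ t , λ w → ¬t (wins⇒won true true G∈ w))
    Left⇒leftNode G∈ (true , t , ¬t) =
      inj₂ (won⇒wins false true G∈ t , λ w → ¬t (wins⇒won true false G∈ w))

    leftPath⇒path : ∀ {x G} → LeftPath x G → Path (palette R) x G
    leftPath⇒path (K , K-child , x∈K , right , below) =
      K , K-child , x∈K , (λ left → right (leftNode⇒Left (proj₁ K-child) left)) ,
      λ H below-H → Left⇒leftNode (proj₁ below-H) (below H below-H)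

  representative : Subset card → Maybe (Fin card)
  representative G = witness (any? λ x → leftPath? x G)

  representative-path : ∀ {G x} R → representative G ≡ just x → Path (palette R) x G
  representative-path {G} R eq =
    leftPath⇒path R (witness-sound (any? λ x → leftPath? x G) eq)

  representative-exists : ∀ {K G} → Child K G → ∃ λ x → representative G ≡ just x
  representative-exists {K} {G} K-child =
    witness-complete (any? λ x → leftPath? x G) (leftPath-exists K-child)

  isRepresentative? : ∀ x → Dec (∃ λ G → representative G ≡ just x)
  isRepresentative? x = anySubset? λ G → Maybeₚ.≡-dec _≟_ (representative G) (just x)

  goodPalette : Fin 5 → Subset card
  goodPalette = palette ⟪ isRepresentative? ⟫

  -- A painted element is the representative of some `H` and has a path to `H`. If it also has a
  -- path to `G`, then `H` is `G` by `path-functional`, so it is the one representative chosen for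
  -- `G`.
  good : paint goodPalette [ [] , [] ]⊨ uniquelyRepresented
  good G (K , K-child) =
    (let x , eq = representative-exists K-child in
     x , ∈⇒T (∈-⟪⟫⁺ isRepresentative? (G , eq)) ,
     representative-path ⟪ isRepresentative? ⟫ eq) ,
    λ x y ((y-painted , y-path) , (x-painted , x-path)) →
      just-injective (trans (sym (isRep y y-painted y-path)) (isRep x x-painted x-path))
    where
    isRep : ∀ x → T (lookup ⟪ isRepresentative? ⟫ x) → Path goodPalette x G →
            representative G ≡ just x
    isRep x x-painted x-path =
      let H , eq = ∈-⟪⟫⁻ isRepresentative? (T⇒∈ x-painted) in
      subst (λ H → representative H ≡ just x)
        (path-functional goodPalette
          (representative-path ⟪ isRepresentative? ⟫ eq) x-path) eq

-- Interpretations and the token structure.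

module _ (I : Interpretation Σ Γ) (𝔸 : Structure Σ) where

  private
    inDomain? : ∀ x → Dec (𝔸 [ x ∷ [] , [] ]⊨ domainFormula I)
    inDomain? x = 𝔸 [ x ∷ [] , [] ]⊨? domainFormula I

  embed-injective : ∀ {i j} → embed I 𝔸 i ≡ embed I 𝔸 j → i ≡ j
  embed-injective = lookup-injective (Unique.filter⁺ inDomain? (Unique.allFin⁺ (size 𝔸)))

  embed-sound : {P : Fin (size 𝔸) → Set} →
                (∀ x → 𝔸 [ x ∷ [] , [] ]⊨ domainFormula I → P x) → ∀ i → P (embed I 𝔸 i)
  embed-sound p i =
    p (embed I 𝔸 i) (proj₂ (∈-filter⁻ inDomain? {xs = allFin (size 𝔸)} (∈-lookup i)))

  embed-complete : ∀ {x} → 𝔸 [ x ∷ [] , [] ]⊨ domainFormula I → ∃ λ i → embed I 𝔸 i ≡ x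
  embed-complete {x} p =
    let x∈ = ∈-filter⁺ inDomain? (∈-allFin x) p in
    ListAny.index x∈ , sym (lookup-index x∈)

-- The relation `(i , j)` compares the node named by `x` as a token of kind `i` with the one named
-- by `y` as a token of kind `j`. Computing these relations before copying spares the later formulas
-- all reference to the family.
tokenVocabulary : Vocabulary
tokenVocabulary = record
  { RelName   = Fin 2 × Fin 2
  ; relArity  = λ _ → 2
  ; PredName  = ⊥
  ; predArity = λ ()
  }

tokens : Interpretation (colouredVocabulary setVocabulary 5) tokenVocabulary
tokens = record
  { domainFormula = ¬̇ ⊥̇
  ; relFormula    = λ (i , j) →
      ∃ˢ (∃ˢ (represents i 0F 1F ∧̇ represents j 1F 0F ∧̇ 1F ⊆̇ 0F))
  ; predFormula   = λ ()
  }

linkedAs : Fin 2 → Fin 2 → Fin e → Fin e → Formula (copiedVocabulary tokenVocabulary 1) e s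
linkedAs i j u v = ∃ᵉ (∃ᵉ
  ( relation (inj₂ i) (suc (suc u) ∷ 1F ∷ [])
  ∧̇ relation (inj₂ j) (suc (suc v) ∷ 0F ∷ [])
  ∧̇ relation (inj₁ (i , j)) (1F ∷ 0F ∷ [])))

linked : Fin e → Fin e → Formula (copiedVocabulary tokenVocabulary 1) e s
linked u v =
  linkedAs 0F 0F u v ∨̇ linkedAs 0F 1F u v ∨̇ linkedAs 1F 0F u v ∨̇ linkedAs 1F 1F u v

-- The i-th copy of an element is kept iff the element represents something
-- as a token of kind i, that is, iff the copy is linked to itself.
nodes : Interpretation (copiedVocabulary tokenVocabulary 1) descVocabulary
nodes = record
  { domainFormula = linked 0F 0F
  ; relFormula    = λ { desc → linked 0F 1F }
  ; predFormula   = λ ()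
  }

-- The composition of atomic transductions.

module Pipeline (Σ Γ Δ : Vocabulary) (k l : ℕ)
  (χ : Sentence (colouredVocabulary Σ k))
  (I : Interpretation (colouredVocabulary Σ k) Γ)
  (J : Interpretation (copiedVocabulary Γ l) Δ) where

  pipeline : MSOTransduction Σ Δ
  pipeline =
    colouring k ∷ filtering χ ∷ interpretation I ∷ copying l ∷ [ interpretation J ]⁺

  pipeline⁺ : ∀ 𝔸 c → colour {Σ} {k} 𝔸 c [ [] , [] ]⊨ χ →
              ⟦ pipeline ⟧ 𝔸 (interpret J (copies l {Γ} (interpret I (colour {Σ} {k} 𝔸 c))))
  pipeline⁺ 𝔸 c good =
    colour {Σ} {k} 𝔸 c , (c , refl) , colour {Σ} {k} 𝔸 c , (good , refl) ,
    interpret I (colour {Σ} {k} 𝔸 c) , refl ,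
    copies l {Γ} (interpret I (colour {Σ} {k} 𝔸 c)) , refl , refl

  pipeline⁻ : ∀ 𝔸 𝔹 → ⟦ pipeline ⟧ 𝔸 𝔹 →
              ∃ λ c → (colour {Σ} {k} 𝔸 c [ [] , [] ]⊨ χ) ×
                𝔹 ≡ interpret J (copies l {Γ} (interpret I (colour {Σ} {k} 𝔸 c)))
  pipeline⁻ _ _ (_ , (c , refl) , _ , (good , refl) , _ , refl , _ , refl , refl) =
    c , good , refl

-- Links between copies of tokens.

module Copies (𝔐 : Structure tokenVocabulary) where

  LinkedAs : Fin 2 → Fin 2 → Fin (2 * size 𝔐) → Fin (2 * size 𝔐) → Set
  LinkedAs i j u v = ∃ λ x → ∃ λ y →
    u ≡ combine {2} i x × v ≡ combine {2} j y × T (rel 𝔐 (i , j) (x ∷ y ∷ []))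

  Linked : Fin (2 * size 𝔐) → Fin (2 * size 𝔐) → Set
  Linked u v = ∃ λ i → ∃ λ j → LinkedAs i j u v

  isOriginal : ∀ x → original 1 {size 𝔐} x ∈ originals 1 {size 𝔐}
  isOriginal x = ∈-⟪⟫⁺
    (λ y → any? λ z → (z ∈? Subset.⊤) ×-dec (original 1 {size 𝔐} z ≟ y)) (x , ∈⊤ , refl)

  module _ (i : Fin 2) {u v : Fin (2 * size 𝔐)} where

    copyOf? : Dec (∃ λ x → u ≡ combine {2} {size 𝔐} i x × v ≡ original 1 {size 𝔐} x)
    copyOf? = any? λ x → (u ≟ combine {2} {size 𝔐} i x) ×-dec (v ≟ original 1 {size 𝔐} x)

    copyOf⁺ : (∃ λ x → u ≡ combine {2} {size 𝔐} i x × v ≡ original 1 {size 𝔐} x) →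
              T (rel (copies 1 {tokenVocabulary} 𝔐) (inj₂ i) (u ∷ v ∷ []))
    copyOf⁺ = does⁺ copyOf?

    copyOf⁻ : T (rel (copies 1 {tokenVocabulary} 𝔐) (inj₂ i) (u ∷ v ∷ [])) →
              ∃ λ x → u ≡ combine {2} {size 𝔐} i x × v ≡ original 1 {size 𝔐} x
    copyOf⁻ = does⁻ copyOf?

  originals? : ∀ (x y : Fin (2 * size 𝔐)) →
               Dec (VecAll.All (_∈ originals 1 {size 𝔐}) (x ∷ y ∷ []))
  originals? x y = VecAll.all? (_∈? originals 1 {size 𝔐}) (x ∷ y ∷ [])

  remainder-original : ∀ x → remainder {2} (size 𝔐) (original 1 {size 𝔐} x) ≡ x
  remainder-original x = cong proj₂ (remQuot-combine {2} 0F x)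

  module _ {e : ℕ} (ρ : Vec (Fin (2 * size 𝔐)) e) (u v : Fin e) where

    linkedAs⁺ : ∀ i j → LinkedAs i j (lookup ρ u) (lookup ρ v) →
                copies 1 {tokenVocabulary} 𝔐 [ ρ , [] ]⊨ linkedAs i j u v
    linkedAs⁺ i j (x , y , u≡ , v≡ , t) =
      original 1 {size 𝔐} x , original 1 {size 𝔐} y ,
      copyOf⁺ i (x , u≡ , refl) ,
      copyOf⁺ j (y , v≡ , refl) ,
      Equivalence.from T-∧
        ( does⁺ (originals? (original 1 {size 𝔐} x) (original 1 {size 𝔐} y))
            (isOriginal x VecAll.∷ isOriginal y VecAll.∷ VecAll.[])
        , subst T (sym (cong₂ (λ x y → rel 𝔐 (i , j) (x ∷ y ∷ []))
            (remainder-original x) (remainder-original y))) t)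

    linkedAs⁻ : ∀ i j → copies 1 {tokenVocabulary} 𝔐 [ ρ , [] ]⊨ linkedAs i j u v →
                LinkedAs i j (lookup ρ u) (lookup ρ v)
    linkedAs⁻ i j (x , y , u-copy , v-copy , r)
      with copyOf⁻ i u-copy | copyOf⁻ j v-copy
    ... | x , u≡ , refl | y , v≡ , refl =
      x , y , u≡ , v≡ ,
      subst T (cong₂ (λ x y → rel 𝔐 (i , j) (x ∷ y ∷ []))
        (remainder-original x) (remainder-original y))
        (proj₂ (Equivalence.to T-∧ r))

    linked⁺ : Linked (lookup ρ u) (lookup ρ v) →
              copies 1 {tokenVocabulary} 𝔐 [ ρ , [] ]⊨ linked u v
    linked⁺ (0F , 0F , l) = inj₁ (linkedAs⁺ 0F 0F l)
    linked⁺ (0F , 1F , l) = inj₂ (inj₁ (linkedAs⁺ 0F 1F l))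
    linked⁺ (1F , 0F , l) = inj₂ (inj₂ (inj₁ (linkedAs⁺ 1F 0F l)))
    linked⁺ (1F , 1F , l) = inj₂ (inj₂ (inj₂ (linkedAs⁺ 1F 1F l)))

    linked⁻ : copies 1 {tokenVocabulary} 𝔐 [ ρ , [] ]⊨ linked u v →
              Linked (lookup ρ u) (lookup ρ v)
    linked⁻ (inj₁ p)               = 0F , 0F , linkedAs⁻ 0F 0F p
    linked⁻ (inj₂ (inj₁ p))        = 0F , 1F , linkedAs⁻ 0F 1F p
    linked⁻ (inj₂ (inj₂ (inj₁ p))) = 1F , 0F , linkedAs⁻ 1F 0F p
    linked⁻ (inj₂ (inj₂ (inj₂ p))) = 1F , 1F , linkedAs⁻ 1F 1F p

  nodes-domain : ∀ u →
    (copies 1 {tokenVocabulary} 𝔐 [ u ∷ [] , [] ]⊨ domainFormula nodes) ⇔ Linked u u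
  nodes-domain u = mk⇔ (linked⁻ (u ∷ []) 0F 0F) (linked⁺ (u ∷ []) 0F 0F)

  nodes-desc : ∀ u v →
    (copies 1 {tokenVocabulary} 𝔐 [ u ∷ v ∷ [] , [] ]⊨ relFormula nodes desc) ⇔ Linked u v
  nodes-desc u v = mk⇔ (linked⁻ (u ∷ v ∷ []) 0F 1F) (linked⁺ (u ∷ v ∷ []) 0F 1F)

-- All that decoding needs: a pair of a kind and an element names at most one member, every member
-- has exactly one name, and the relations of `𝔐` are inclusion between named members.
record Encoding (S : SetSystem) (𝔐 : Structure tokenVocabulary) : Set₁ where
  open SetSystem S
  field
    Token            : Fin 2 → Fin (size 𝔐) → Subset card → Set
    token-member     : ∀ i {x G} → Token i x G → G ∈𝓕
    token-functional : ∀ i {x G H} → Token i x G → Token i x H → G ≡ H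
    token-total      : ∀ {G} → G ∈𝓕 → ∃ λ i → ∃ λ x → Token i x G
    token-injective  : ∀ i j {x y G} → Token i x G → Token j y G → (i , x) ≡ (j , y)
    token-below      : ∀ i j {x y} → T (rel 𝔐 (i , j) (x ∷ y ∷ [])) ⇔
                       (∃ λ G → ∃ λ H → Token i x G × Token j y H × G ⊑ H)

-- From an encoding to the laminar tree.

module Decoding {S : SetSystem} {𝔐 : Structure tokenVocabulary}
  (encoding : Encoding S 𝔐) where
  open SetSystem S
  open Encoding encoding
  open Copies 𝔐

  Denotes : Fin (2 * size 𝔐) → Subset card → Set
  Denotes u G = ∃ λ i → ∃ λ x → u ≡ combine {2} i x × Token i x G

  linked⇒denotes : ∀ {u v} → Linked u v → ∃ λ G → ∃ λ H → Denotes u G × Denotes v H × G ⊑ H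
  linked⇒denotes (i , j , x , y , u≡ , v≡ , t) =
    let G , H , r , r′ , G⊑H = Equivalence.to (token-below i j) t in
    G , H , (i , x , u≡ , r) , (j , y , v≡ , r′) , G⊑H

  denotes⇒linked : ∀ {u v G H} → Denotes u G → Denotes v H → G ⊑ H → Linked u v
  denotes⇒linked {G = G} {H} (i , x , u≡ , r) (j , y , v≡ , r′) G⊑H =
    i , j , x , y , u≡ , v≡ , Equivalence.from (token-below i j) (G , H , r , r′ , G⊑H)

  denotes-member : ∀ {u G} → Denotes u G → G ∈𝓕
  denotes-member (i , _ , _ , r) = token-member i r

  denotes-functional : ∀ {u G H} → Denotes u G → Denotes u H → G ≡ H
  denotes-functional (i , x , refl , r) (j , y , eq , r′)
    with refl , refl ← combine-injective i x j y eq = token-functional i r r′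

  denotes-injective : ∀ {u v G} → Denotes u G → Denotes v G → u ≡ v
  denotes-injective (i , x , refl , r) (j , y , refl , r′) =
    cong (λ (i , x) → combine {2} i x) (token-injective i j r r′)

  denotes-total : ∀ {G} → G ∈𝓕 → ∃ λ u → Denotes u G
  denotes-total G∈ =
    let i , x , r = token-total G∈ in
    combine {2} i x , i , x , refl , r

  node : Fin (size (interpret nodes (copies 1 {tokenVocabulary} 𝔐))) → Fin (2 * size 𝔐)
  node = embed nodes (copies 1 {tokenVocabulary} 𝔐)

  node-linked : ∀ u → Linked (node u) (node u)
  node-linked = embed-sound nodes (copies 1 {tokenVocabulary} 𝔐) {P = λ u → Linked u u}
    (λ u → Equivalence.to (nodes-domain u))

  denotation : ∀ u → ∃ λ G → Denotes (node u) G
  denotation u =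
    let G , _ , d , _ = linked⇒denotes {node u} {node u} (node-linked u) in G , d

  set : Fin (size (interpret nodes (copies 1 {tokenVocabulary} 𝔐))) → Subset card
  set u = proj₁ (denotation u)

  set∈𝓕 : ∀ u → set u ∈𝓕
  set∈𝓕 u = denotes-member (proj₂ (denotation u))

  set-injective : ∀ {u v} → set u ≡ set v → u ≡ v
  set-injective {u} {v} eq = embed-injective nodes (copies 1 {tokenVocabulary} 𝔐)
    (denotes-injective (proj₂ (denotation u))
      (subst (Denotes (node v)) (sym eq) (proj₂ (denotation v))))

  set-surjective : ∀ {G} → G ∈𝓕 → ∃ λ u → set u ≡ G
  set-surjective G∈ =
    let t , d  = denotes-total G∈
        u , eq = embed-complete nodes (copies 1 {tokenVocabulary} 𝔐)
                   (Equivalence.from (nodes-domain t) (denotes⇒linked d d (λ _ x∈ → x∈))) in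
    u , denotes-functional (proj₂ (denotation u)) (subst (λ t → Denotes t _) (sym eq) d)

  module _ (T : LaminarTree S) where
    open LaminarTree T using (tree; setOf; descendant⇔⊆) renaming (nodes to treeNodes)
    open RootedTree tree using (Vertex; Descendant; descendant?)

    setOf-injective : ∀ {x y} → setOf x ≡ setOf y → x ≡ y
    setOf-injective eq = Bijection.injective treeNodes (member-≡ eq)
      where
      member-≡ : {X Y : ∃ _∈𝓕} → proj₁ X ≡ proj₁ Y → X ≡ Y
      member-≡ {X , p} {_ , q} refl = cong (X ,_) (T-irrelevant p q)

    vertex : ∀ {G} → G ∈𝓕 → ∃ λ x → setOf x ≡ G
    vertex {G} G∈ =
      let x , eq = Bijection.strictlySurjective treeNodes (G , G∈) in x , cong proj₁ eq

    toVertex : Fin (size (interpret nodes (copies 1 {tokenVocabulary} 𝔐))) → Vertex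
    toVertex u = proj₁ (vertex (set∈𝓕 u))

    setOf-toVertex : ∀ u → setOf (toVertex u) ≡ set u
    setOf-toVertex u = proj₂ (vertex (set∈𝓕 u))

    linked⇔descendant : ∀ u v →
      Linked (node u) (node v) ⇔ Descendant (toVertex u) (toVertex v)
    linked⇔descendant u v = mk⇔
      (λ l →
        let G , H , d , d′ , G⊑H = linked⇒denotes l
            set-u = trans (setOf-toVertex u) (denotes-functional (proj₂ (denotation u)) d)
            set-v = trans (setOf-toVertex v) (denotes-functional (proj₂ (denotation v)) d′)
        in
        Equivalence.from (descendant⇔⊆ (toVertex u) (toVertex v))
          λ {x} x∈ → subst (x ∈_) (sym set-v) (G⊑H x (subst (x ∈_) set-u x∈)))
      (λ u↝v → denotes⇒linked (proj₂ (denotation u)) (proj₂ (denotation v))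
        λ x x∈ → subst (x ∈_) (setOf-toVertex v)
          (Equivalence.to (descendant⇔⊆ (toVertex u) (toVertex v)) u↝v
            (subst (x ∈_) (sym (setOf-toVertex u)) x∈)))

    -- The elements on both sides correspond bijectively to the members of the family, and under
    -- these bijections both relations become inclusion.
    output≅tree : interpret nodes (copies 1 {tokenVocabulary} 𝔐) ≅ treeStructure tree
    output≅tree = record
      { bijection = mk⤖ {to = toVertex}
          ( (λ {u} {v} eq → set-injective
              (trans (sym (setOf-toVertex u)) (trans (cong setOf eq) (setOf-toVertex v))))
          , strictlySurjective⇒surjective λ x →
              let u , eq = set-surjective (proj₂ (Bijection.to treeNodes x)) in
              u , setOf-injective (trans (setOf-toVertex u) eq))
      ; rel-preserved  = λ { desc (u ∷ v ∷ []) → does-⇔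
          (linked⇔descendant u v ⇔-∘ nodes-desc (node u) (node v))
          (copies 1 {tokenVocabulary} 𝔐 [ node u ∷ node v ∷ [] , [] ]⊨?
            relFormula nodes desc)
          (descendant? (toVertex u) (toVertex v)) }
      ; pred-preserved = λ ()
      }

-- Every colouring that passes the filter yields an encoding.

module Soundness (S : SetSystem) (laminar : IsLaminar S)
  (c : Fin 5 → Subset (SetSystem.card S))
  (unique : colour {setVocabulary} {5} (setStructure S) c [ [] , [] ]⊨ uniquelyRepresented)
  where
  open SetSystem S
  open Family S laminar
  open Representation S laminar using (path-functional)

  Represents : Fin 2 → Fin card → Subset card → Set
  Represents i x G = paint c [ x ∷ [] , G ∷ [] ]⊨ represents i 0F 0F

  module _ {e s : ℕ} {ρ : Vec (Fin card) e} {σ : Vec (Subset card) s}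
    {x : Fin e} {X : Fin s} where

    -- The formula unfolds only for a known kind; then both sides agree definitionally.
    represents⁻ : ∀ i → paint c [ ρ , σ ]⊨ represents i x X →
                  Represents i (lookup ρ x) (lookup σ X)
    represents⁻ 0F r = r
    represents⁻ 1F r = r

    represents⁺ : ∀ i → Represents i (lookup ρ x) (lookup σ X) →
                  paint c [ ρ , σ ]⊨ represents i x X
    represents⁺ 0F r = r
    represents⁺ 1F r = r

  represents-member : ∀ i {x G} → Represents i x G → G ∈𝓕
  represents-member 0F (G∈ , _)              = G∈
  represents-member 1F (_ , _ , K-child , _) = proj₁ (proj₂ K-child)

  leaf-singleton : ∀ {x G} → Represents 0F x G → G ≡ ⁅ x ⁆
  leaf-singleton {x} (_ , x∈G , only) =
    ⊑-antisym (λ y y∈G → subst (_∈ ⁅ x ⁆) (sym (only y y∈G)) (x∈⁅x⁆ x)) (⁅⁆-⊑ x∈G)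

  inner-child : ∀ {x G} → Represents 1F x G → ∃ λ K → Child K G
  inner-child (_ , K , K-child , _) = K , K-child

  leaf≢inner : ∀ {x y G} → Represents 0F x G → ¬ Represents 1F y G
  leaf≢inner r r′ =
    let K , K-child = inner-child r′ in
    singleton-childless (subst (Child K) (leaf-singleton r) K-child)

  represents-functional : ∀ i {x G H} → Represents i x G → Represents i x H → G ≡ H
  represents-functional 0F r       r′       =
    trans (leaf-singleton r) (sym (leaf-singleton r′))
  represents-functional 1F (_ , p) (_ , p′) = path-functional c p p′

  represents-total : ∀ {G} → G ∈𝓕 → ∃ λ i → ∃ λ x → Represents i x G
  represents-total G∈ =
    let x , x∈G = members-nonempty G∈ in [ leaf G∈ x∈G , inner ]′ (leafOrInner G∈ x∈G)
    where
    leaf : ∀ {G x} → G ∈𝓕 → x ∈ G → G ≡ ⁅ x ⁆ → ∃ λ i → ∃ λ y → Represents i y G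
    leaf {x = x} G∈ x∈G refl = 0F , x , G∈ , x∈G , λ y y∈ → x∈⁅y⁆⇒x≡y x y∈

    inner : ∀ {G x} → (∃ λ K → Child K G × x ∈ K) → ∃ λ i → ∃ λ y → Represents i y G
    inner {G} (K , K-child , _) = 1F , proj₁ (unique G (K , K-child))

  represents-injective : ∀ i j {x y G} → Represents i x G → Represents j y G →
                         (i , x) ≡ (j , y)
  represents-injective 0F 0F (_ , x∈G , _) (_ , _ , only) = cong (0F ,_) (only _ x∈G)
  represents-injective 0F 1F r r′ = contradiction r′ (leaf≢inner r)
  represents-injective 1F 0F r r′ = contradiction r (leaf≢inner r′)
  represents-injective 1F 1F {x} {y} {G} r r′ =
    -- The outer quantifier of the uniqueness clause binds `1F`, so `y` comes before `x`.
    cong (1F ,_) (proj₂ (unique G (inner-child r)) y x (r , r′))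

  𝔐 : Structure tokenVocabulary
  𝔐 = interpret tokens (paint c)

  element : Fin (size 𝔐) → Fin card
  element = embed tokens (paint c)

  Below : Fin 2 → Fin 2 → Fin (size 𝔐) → Fin (size 𝔐) → Set
  Below i j x y = ∃ λ G → ∃ λ H →
    Represents i (element x) G × Represents j (element y) H × G ⊑ H

  below⁺ : ∀ i j {x y} → Below i j x y → T (rel 𝔐 (i , j) (x ∷ y ∷ []))
  below⁺ i j {x} {y} (G , H , r , r′ , G⊑H) =
    does⁺ (paint c [ element x ∷ element y ∷ [] , [] ]⊨? relFormula tokens (i , j))
      (G , H , represents⁺ i r , represents⁺ j r′ , G⊑H)

  below⁻ : ∀ i j {x y} → T (rel 𝔐 (i , j) (x ∷ y ∷ [])) → Below i j x y
  below⁻ i j {x} {y} t =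
    let G , H , r , r′ , G⊑H = does⁻
          (paint c [ element x ∷ element y ∷ [] , [] ]⊨? relFormula tokens (i , j)) t in
    G , H , represents⁻ i r , represents⁻ j r′ , G⊑H

  element-total : ∀ {G} → G ∈𝓕 → ∃ λ i → ∃ λ z → Represents i (element z) G
  element-total {G} G∈ =
    let i , x , r = represents-total G∈
        z , eq    = embed-complete tokens (paint c) {x} (λ ()) in
    i , z , subst (λ x → Represents i x G) (sym eq) r

  element-injective : ∀ i j {x y G} →
                      Represents i (element x) G → Represents j (element y) G →
                      (i , x) ≡ (j , y)
  element-injective i j {x} {y} {G} r r′ =
    let eq = represents-injective i j {element x} {element y} {G} r r′ in
    cong₂ _,_ (cong proj₁ eq) (embed-injective tokens (paint c) {x} {y} (cong proj₂ eq))

  encoding : Encoding S (interpret tokens (colour {setVocabulary} {5} (setStructure S) c))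
  encoding = record
    { Token            = λ i x G → Represents i (element x) G
    ; token-member     = λ i {x} {G} r → represents-member i {element x} {G} r
    ; token-functional = λ i {x} {G} {H} r r′ →
        represents-functional i {element x} {G} {H} r r′
    ; token-total      = element-total
    ; token-injective  = element-injective
    ; token-below      = λ i j {x} {y} → mk⇔ (below⁻ i j {x} {y}) (below⁺ i j {x} {y})
    }

-- The transduction and its correctness.

open Pipeline
  setVocabulary tokenVocabulary descVocabulary 5 1 uniquelyRepresented tokens nodes

open Representation using (goodPalette; good)

module _ (S : SetSystem) (laminar : IsLaminar S) where

  output-exists : ∃ λ 𝔹 → ⟦ pipeline ⟧ (setStructure S) 𝔹
  output-exists =
    interpret nodes (copies 1 {tokenVocabulary} (interpret tokens
      (colour {setVocabulary} {5} (setStructure S) (goodPalette S laminar)))) ,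
    pipeline⁺ (setStructure S) (goodPalette S laminar) (good S laminar)

  output-correct : ∀ 𝔹 →
    (∃ λ c →
      (colour {setVocabulary} {5} (setStructure S) c [ [] , [] ]⊨ uniquelyRepresented) ×
      𝔹 ≡ interpret nodes (copies 1 {tokenVocabulary}
            (interpret tokens (colour {setVocabulary} {5} (setStructure S) c)))) →
    𝔹 ≅ treeStructure (LaminarTree.tree (laminarTree S laminar))
  output-correct _ (c , unique , refl) = Decoding.output≅tree
    {S} {interpret tokens (colour {setVocabulary} {5} (setStructure S) c)}
    (Soundness.encoding S laminar c unique) (laminarTree S laminar)

theorem2 : ∃ λ (τ : MSOTransduction setVocabulary descVocabulary) →
    (S : SetSystem) (laminar : IsLaminar S) →
    (∃ λ 𝔹 → ⟦ τ ⟧ (setStructure S) 𝔹)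
    × (∀ 𝔹 → ⟦ τ ⟧ (setStructure S) 𝔹 →
    𝔹 ≅ treeStructure (LaminarTree.tree (laminarTree S laminar)))
theorem2 = pipeline , λ S laminar →
  output-exists S laminar ,
  λ 𝔹 run → output-correct S laminar 𝔹
    (pipeline⁻ (setStructure S) 𝔹 run)
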